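{- Let $k\ge1$. For every weakly stable $\Delta^0_2$ $k$-tree-split $f$ on $2^{<\omega}$, there exists a computable coloring $C:[2^{<\omega}]^2\to k$, weakly stable on $2^{<\omega}$, such that every infinite perfect tree $T\subseteq 2^{<\omega}$ for which $C$ restricted to $[T]^2$ is stable on $T$ is homogeneous for $f$.
   Context: Strings are in $2^{<\omega}$, $\preceq$ is the initial segment relation; $[2^{<\omega}]^2$ is the set of two-element sets of distinct compatible strings, $[T]^2$ similarly. A tree is any subset of $2^{<\omega}$ ordered by $\preceq$; an infinite perfect tree is one isomorphic to $(2^{<\omega},\preceq)$. For a tree $T$ and $\rho\in T$, $\mathrm{Pre}_T(\rho)=\{\sigma\in T:\sigma\preceq\rho\}$, $|\rho|_T=|\mathrm{Pre}_T(\rho)|$; an immediate successor of $\rho$ in $T$ is $\rho^+\in T$, $\rho\prec\rho^+$, with no element of $T$ strictly between. For $\zeta\in k^n$, $m\le n$, $\zeta{\upharpoonright}m$ is the first $m$ entries and $A{\upharpoonright}m=\{\zeta{\upharpoonright}m:\zeta\in A\}$; entries of $\zeta\in k^{|\rho|_T}$ are indexed by the elements of $\mathrm{Pre}_T(\rho)$ in increasing order. A coloring $C$ is weakly stable on an infinite tree $T$ if for every $\sigma\in T$ there is $n$ such that for each $\rho\in T$, $\rho\succeq\sigma$, $|\rho|_T=n$, there is $k'<k$ with $C(\{\sigma,\tau\})=k'$ for all $\tau\in T$, $\tau\succ\rho$; $C$ is stable on $T$ if for every $\sigma\in T$ there is $k'$ with $C(\{\sigma,\rho\})=k'$ for all but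 finitely many $\rho\in T$, $\rho\succ\sigma$. A $k$-tree-split on a tree $T$ is a function $f$ from $T$ to finite subsets of $k^{<\omega}$ such that $f(\rho)$ is a nonempty subset of $k^{|\rho|_T}$ and, if $\rho$ is not a leaf of $T$, $f(\rho)=\bigcup\{f(\rho^+){\upharpoonright}|\rho|_T:\rho^+\text{ immediate successor of }\rho\text{ in }T\}$. It is weakly stable if for every $\rho\in T$ there is $d$ such that for all $\rho'\in T$ with $\rho'\succeq\rho$ and $|\rho'|_T\ge d$ there is $\zeta\in f(\rho)$ with $f(\rho'){\upharpoonright}|\rho|_T=\{\zeta\}$. It is $\Delta^0_2$ if it is computable from $\emptyset'$ (values coded canonically). For trees $\hat T\subseteq T$, a tree-split $\hat f$ on $\hat T$ is induced by $f$ if for all $\rho\in\hat T$, $\hat\xi\in\hat f(\rho)$ there is $\xi\in f(\rho)$ such that for all $\sigma\in\hat T$ with $\sigma\preceq\rho$, the entry of $\hat\xi$ indexed by $\sigma$ equals the entry of $\xi$ indexed by $\sigma$. $G\subseteq T$ is homogeneous for $f$ if some $k$-tree-split on $G$ induced by $f$ has only singleton values. -}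

module Defs where

open import Data.Nat using (ℕ; zero; suc; _+_; _*_; _∸_; _^_; _≤_; _<_)
open import Data.Bool using (Bool; true; false; if_then_else_)
open import Data.Fin using (Fin; toℕ)
open import Data.Vec using (Vec; []; _∷_; lookup)
open import Data.List using (List; []; _∷_; _++_; map; length; take; filterᵇ)
open import Data.List.Membership.Propositional using (_∉_)
open import Data.Product using (Σ; ∃; _×_; _,_)
open import Data.Sum using (_⊎_)
open import Data.Empty using (⊥)
open import Data.Maybe using (Maybe; just; nothing)
open import Relation.Nullary using (¬_)
open import Relation.Binary.PropositionalEquality using (_≡_; _≢_)

-- Codes of partial recursive functions of arity n, with primitive
-- oracle calls labelled by elements of O.
data Code (O : Set) : ℕ → Set where
  zer  : ∀ {n} → Code O n
  succ : Code O 1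
  proj : ∀ {n} → Fin n → Code O n
  comp : ∀ {m n} → Code O m → Vec (Code O n) m → Code O n
  prec : ∀ {n} → Code O n → Code O (suc (suc n)) → Code O (suc n)
  mu   : ∀ {n} → Code O (suc n) → Code O n
  orc  : O → Code O 1

-- Big-step evaluation, given the graph R of the oracle functions.
module Evaluation {O : Set} (R : O → ℕ → ℕ → Set) where
  mutual
    data Eval : ∀ {n} → Code O n → Vec ℕ n → ℕ → Set where
      e-zer  : ∀ {n} {xs : Vec ℕ n} → Eval zer xs 0
      e-succ : ∀ {x} → Eval succ (x ∷ []) (suc x)
      e-proj : ∀ {n} {i : Fin n} {xs} → Eval (proj i) xs (lookup xs i)
      e-comp : ∀ {m n} {f : Code O m} {gs : Vec (Code O n) m} {xs ys v} →
               EvalAll gs xs ys → Eval f ys v → Eval (comp f gs) xs v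
      e-prec0 : ∀ {n} {g : Code O n} {h : Code O (suc (suc n))} {xs v} →
               Eval g xs v → Eval (prec g h) (0 ∷ xs) v
      e-precS : ∀ {n} {g : Code O n} {h : Code O (suc (suc n))} {xs y w v} →
               Eval (prec g h) (y ∷ xs) w → Eval h (y ∷ w ∷ xs) v →
               Eval (prec g h) (suc y ∷ xs) v
      e-mu   : ∀ {n} {f : Code O (suc n)} {xs y} →
               Eval f (y ∷ xs) 0 →
               (∀ z → z < y → ∃ λ w → Eval f (z ∷ xs) (suc w)) →
               Eval (mu f) xs y
      e-orc  : ∀ {o x v} → R o x v → Eval (orc o) (x ∷ []) v

    data EvalAll : ∀ {m n} → Vec (Code O n) m → Vec ℕ n → Vec ℕ m → Set where
      []  : ∀ {n} {xs : Vec ℕ n} → EvalAll [] xs []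
      _∷_ : ∀ {m n} {g : Code O n} {gs : Vec (Code O n) m} {xs y ys} →
            Eval g xs y → EvalAll gs xs ys → EvalAll (g ∷ gs) xs (y ∷ ys)

noOracle : ⊥ → ℕ → ℕ → Set
noOracle ()

PCode : ℕ → Set
PCode = Code ⊥

open Evaluation noOracle public using () renaming (Eval to PEval)

Halts : PCode 1 → ℕ → Set
Halts c x = ∃ λ w → PEval c (x ∷ []) w

-- The halting oracle ∅': a query labelled by a plain code c answers
-- whether c halts on the input (1 = yes, 0 = no).
jumpOracle : PCode 1 → ℕ → ℕ → Set
jumpOracle c x v = (v ≡ 1 × Halts c x) ⊎ (v ≡ 0 × ¬ Halts c x)

JCode : ℕ → Set
JCode = Code (PCode 1)

open Evaluation jumpOracle public using () renaming (Eval to JEval)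

Str : Set
Str = List Bool

-- bijective coding of binary strings
encStr : Str → ℕ
encStr []          = 0
encStr (false ∷ s) = suc (2 * encStr s)
encStr (true ∷ s)  = suc (suc (2 * encStr s))

-- pairing ℕ × ℕ → ℕ (bijective)
pair : ℕ → ℕ → ℕ
pair a b = 2 ^ a * (2 * b + 1) ∸ 1

encList : List ℕ → ℕ
encList []       = 0
encList (x ∷ xs) = suc (pair x (encList xs))

_≼_ : Str → Str → Set
σ ≼ τ = ∃ λ υ → σ ++ υ ≡ τ

_≺_ : Str → Str → Set
σ ≺ τ = σ ≼ τ × σ ≢ τ

-- A tree is any subset of 2^{<ω} (given by its characteristic function).
Tree : Set
Tree = Str → Bool

_∈T_ : Str → Tree → Set
ρ ∈T T = T ρ ≡ true

full : Tree
full _ = true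

prefixes : Str → List Str
prefixes []      = [] ∷ []
prefixes (b ∷ s) = [] ∷ map (b ∷_) (prefixes s)

-- Pre_T(ρ), in increasing order, and |ρ|_T
Pre : Tree → Str → List Str
Pre T ρ = filterᵇ T (prefixes ρ)

∣_∣[_] : Str → Tree → ℕ
∣ ρ ∣[ T ] = length (Pre T ρ)

ImmSucc : Tree → Str → Str → Set
ImmSucc T ρ ρ⁺ = ρ⁺ ∈T T × ρ ≺ ρ⁺ × (∀ τ → τ ∈T T → ρ ≺ τ → τ ≺ ρ⁺ → ⊥)

IsLeaf : Tree → Str → Set
IsLeaf T ρ = ∀ τ → τ ∈T T → ρ ≺ τ → ⊥

-- infinite perfect tree: order-isomorphic to (2^{<ω}, ⪯)
record IsPerfect (T : Tree) : Set where
  field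
    h     : Str → Str
    into  : ∀ σ → h σ ∈T T
    onto  : ∀ ρ → ρ ∈T T → ∃ λ σ → h σ ≡ ρ
    mono  : ∀ σ τ → σ ≼ τ → h σ ≼ h τ
    refl' : ∀ σ τ → h σ ≼ h τ → σ ≼ τ

-- f ρ ζ ≡ true means ζ ∈ f(ρ); tuples ζ ∈ k^n are lists of length n
TSplit : ℕ → Set
TSplit k = Str → List (Fin k) → Bool

_∈f_at_ : ∀ {k} → List (Fin k) → TSplit k → Str → Set
ζ ∈f f at ρ = f ρ ζ ≡ true

record IsTreeSplit (k : ℕ) (T : Tree) (f : TSplit k) : Set where
  field
    size     : ∀ ρ → ρ ∈T T → ∀ ζ → ζ ∈f f at ρ → length ζ ≡ ∣ ρ ∣[ T ]
    nonempty : ∀ ρ → ρ ∈T T → ∃ λ ζ → ζ ∈f f at ρ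
    union    : ∀ ρ → ρ ∈T T → ¬ IsLeaf T ρ → ∀ ζ →
               (ζ ∈f f at ρ →
                  ∃ λ ρ⁺ → ImmSucc T ρ ρ⁺ × ∃ λ ζ⁺ → ζ⁺ ∈f f at ρ⁺ × take ∣ ρ ∣[ T ] ζ⁺ ≡ ζ)
             × ((∃ λ ρ⁺ → ImmSucc T ρ ρ⁺ × ∃ λ ζ⁺ → ζ⁺ ∈f f at ρ⁺ × take ∣ ρ ∣[ T ] ζ⁺ ≡ ζ) →
                  ζ ∈f f at ρ)

WeaklyStableSplit : ∀ {k} → Tree → TSplit k → Set
WeaklyStableSplit T f =
  ∀ ρ → ρ ∈T T → ∃ λ d → ∀ ρ' → ρ' ∈T T → ρ ≼ ρ' → d ≤ ∣ ρ' ∣[ T ] →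
    ∃ λ ζ → ζ ∈f f at ρ ×
      (∀ ξ → ((∃ λ ζ' → ζ' ∈f f at ρ' × take ∣ ρ ∣[ T ] ζ' ≡ ξ) → ξ ≡ ζ)
           × (ξ ≡ ζ → ∃ λ ζ' → ζ' ∈f f at ρ' × take ∣ ρ ∣[ T ] ζ' ≡ ξ))

-- Δ⁰₂: the (characteristic function of the) split is computable from ∅'
Delta02Split : ∀ {k} → TSplit k → Set
Delta02Split f = ∃ λ (c : JCode 2) → ∀ ρ ζ →
  JEval c (encStr ρ ∷ encList (map toℕ ζ) ∷ []) (if f ρ ζ then 1 else 0)

nth : ∀ {A : Set} → List A → ℕ → Maybe A
nth []       _       = nothing
nth (x ∷ xs) zero    = just x
nth (x ∷ xs) (suc n) = nth xs n

-- the entry of ζ ∈ k^{|ρ|_T} indexed by σ ∈ Pre_T(ρ)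
entry : ∀ {k} → Tree → List (Fin k) → Str → Maybe (Fin k)
entry T ζ σ = nth ζ (∣ σ ∣[ T ] ∸ 1)

Induced : ∀ {k} → Tree → TSplit k → Tree → TSplit k → Set
Induced Th fh T f =
  ∀ ρ → ρ ∈T Th → ∀ ξh → ξh ∈f fh at ρ →
    ∃ λ ξ → ξ ∈f f at ρ × (∀ σ → σ ∈T Th → σ ≼ ρ → entry Th ξh σ ≡ entry T ξ σ)

Homogeneous : (k : ℕ) → Tree → Tree → TSplit k → Set
Homogeneous k G T f =
  ∃ λ (fh : TSplit k) → IsTreeSplit k G fh × Induced G fh T f ×
    (∀ ρ → ρ ∈T G → ∃ λ ζ → ∀ ξ → (ξ ∈f fh at ρ → ξ ≡ ζ) × (ξ ≡ ζ → ξ ∈f fh at ρ))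

-- C σ τ is the color of {σ, τ} when σ ≺ τ (other values irrelevant)
Coloring : ℕ → Set
Coloring k = Str → Str → Fin k

ComputableColoring : ∀ {k} → Coloring k → Set
ComputableColoring C = ∃ λ (c : PCode 2) → ∀ σ τ → σ ≺ τ →
  PEval c (encStr σ ∷ encStr τ ∷ []) (toℕ (C σ τ))

WeaklyStableColoring : ∀ {k} → Tree → Coloring k → Set
WeaklyStableColoring {k} T C =
  ∀ σ → σ ∈T T → ∃ λ n → ∀ ρ → ρ ∈T T → σ ≼ ρ → ∣ ρ ∣[ T ] ≡ n →
    ∃ λ (k' : Fin k) → ∀ τ → τ ∈T T → ρ ≺ τ → C σ τ ≡ k'

StableColoring : ∀ {k} → Tree → Coloring k → Set
StableColoring {k} T C =
  ∀ σ → σ ∈T T → ∃ λ (k' : Fin k) → ∃ λ (L : List Str) →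
    ∀ ρ → ρ ∈T T → σ ≺ ρ → ρ ∉ L → C σ ρ ≡ k'

{-# OPTIONS --safe #-}

-- Since f is Δ⁰₂ it is a limit of computable approximations: answering each query to ∅'
-- by "halts within s steps" and bounding every search by s, the stage-s evaluation of a
-- code for f converges, so for each L it is eventually correct on all strings of length
-- at most L. The colouring C(σ, τ) evaluates at the stage given by the code of τ: it looks
-- for the shortest prefix τ↾ℓ with ℓ ≥ |σ| at which all tuples of the approximation of
-- f(τ↾ℓ) agree at position |σ|, and returns that common entry. Weak stability of f
-- provides such a prefix of bounded length, so for all long enough τ, C(σ, τ) is the entry
-- at |σ| of every tuple of f(τ), which makes C weakly stable. If C is stable on a perfect
-- tree T, the limit colours of the T-predecessors of a node ρ ∈ T are the entries of a
-- tuple of f(ρ), obtained by restricting a tuple of f(τ) for some τ ∈ T far above ρ;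
-- assigning this single tuple to every ρ shows that T is homogeneous for f.

module Submission where

open import Defs
open import Data.Bool using (Bool; true; false; T; T?; not; _∧_; if_then_else_)
open import Data.Bool.Properties using (T-∧; T-≡)
open import Data.Empty using (⊥; ⊥-elim)
open import Data.Fin using (Fin; zero; suc; toℕ; fromℕ<; _↑ʳ_; #_)
open import Data.Fin.Properties using (toℕ<n; toℕ-fromℕ<; toℕ-injective) renaming (_≟_ to _≟ᶠ_)
open import Data.List using (List; []; _∷_; _++_; length; take; drop; map; replicate; applyUpTo; filterᵇ)
open import Data.List.Extrema.Nat using (max; xs≤max)
open import Data.List.Membership.Propositional using (_∉_)
open import Data.List.Membership.Propositional.Properties using (∈-map⁺; ∈-applyUpTo⁺)
open import Data.List.Properties
  using ( ++-assoc; ++-identityʳ; length-++; length-map; length-drop; length-take; length-replicate; map-++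
        ; take-take; take-all; take++drop≡id; drop-drop; drop-map; drop-all; filter-++; filter-accept; filter-all; ≡-dec )
import Data.List.Relation.Unary.All as All
import Data.Maybe
open import Data.Maybe using (just)
open import Data.Maybe.Properties using (just-injective)
open import Data.Nat
open import Data.Nat.Properties
open import Data.Product using (Σ; ∃; _×_; _,_; proj₁; proj₂)
open import Data.Sum using (inj₁; inj₂)
open import Data.Vec as Vec using (Vec; []; _∷_)
open import Data.Vec.Properties using (tabulate∘lookup; tabulate-cong; lookup-++ʳ; map-∘; map-id)
open import Function using (_∘_; _$_; case_of_)
open import Function.Bundles using (Equivalence)
open import Relation.Binary.PropositionalEquality
open import Relation.Nullary using (¬_; yes; no; does)
open import Relation.Nullary.Decidable using (decidable-stable)

module PE = Evaluation noOracle

-- Computable functions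

record Computable (n : ℕ) (F : Vec ℕ n → ℕ) : Set where
  constructor computable
  field
    code     : PCode n
    computes : ∀ xs → PEval code xs (F xs)

open Computable

Computable-resp : ∀ {n} {F G : Vec ℕ n → ℕ} → F ≗ G → Computable n F → Computable n G
Computable-resp F≗G (computable c ev) = computable c (λ xs → subst (PEval c xs) (F≗G xs) (ev xs))

zero-computable : ∀ {n} → Computable n (λ _ → 0)
zero-computable = computable zer (λ _ → PE.e-zer)

arg : ∀ {n} (i : Fin n) → Computable n (λ xs → Vec.lookup xs i)
arg i = computable (proj i) (λ _ → PE.e-proj)

Computable₁ : (ℕ → ℕ) → Set
Computable₁ f = Computable 1 (λ xs → f (Vec.lookup xs zero))

Computable₂ : (ℕ → ℕ → ℕ) → Set
Computable₂ f = Computable 2 (λ xs → f (Vec.lookup xs zero) (Vec.lookup xs (suc zero)))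

suc-computable : Computable₁ suc
suc-computable = computable succ (λ { (x ∷ []) → PE.e-succ })

data Computables (n : ℕ) : ℕ → Set where
  []  : Computables n 0
  _∷_ : ∀ {m} {G : Vec ℕ n → ℕ} → Computable n G → Computables n m → Computables n (suc m)

values : ∀ {n m} → Computables n m → Vec ℕ n → Vec ℕ m
values []                   xs = []
values (_∷_ {G = G} _ gs) xs = G xs ∷ values gs xs

codes : ∀ {n m} → Computables n m → Vec (PCode n) m
codes []       = []
codes (g ∷ gs) = code g ∷ codes gs

computesAll : ∀ {n m} (gs : Computables n m) xs → PE.EvalAll (codes gs) xs (values gs xs)
computesAll []       xs = PE.[]
computesAll (g ∷ gs) xs = computes g xs PE.∷ computesAll gs xs

compose : ∀ {n m} {F : Vec ℕ m → ℕ} → Computable m F → (gs : Computables n m) →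
          Computable n (λ xs → F (values gs xs))
compose f gs = computable (comp (code f) (codes gs)) (λ xs → PE.e-comp (computesAll gs xs) (computes f _))

recursion : ∀ {n} {G H} (F : Vec ℕ (suc n) → ℕ) → Computable n G → Computable (suc (suc n)) H →
            (∀ xs → F (0 ∷ xs) ≡ G xs) → (∀ y xs → F (suc y ∷ xs) ≡ H (y ∷ F (y ∷ xs) ∷ xs)) →
            Computable (suc n) F
recursion F g h base step = computable (prec (code g) (code h)) go
  where
  go : ∀ xs → PEval (prec (code g) (code h)) xs (F xs)
  go (zero ∷ xs)  = subst (PEval _ _) (sym (base xs)) (PE.e-prec0 (computes g xs))
  go (suc y ∷ xs) = subst (PEval _ _) (sym (step y xs)) (PE.e-precS (go (y ∷ xs)) (computes h _))

projections : ∀ {n m} → (Fin m → Fin n) → Computables n m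
projections {m = zero}  ι = []
projections {m = suc m} ι = arg (ι zero) ∷ projections (ι ∘ suc)

values-projections : ∀ {n m} (ι : Fin m → Fin n) xs →
                     values (projections ι) xs ≡ Vec.tabulate (Vec.lookup xs ∘ ι)
values-projections {m = zero}  ι xs = refl
values-projections {m = suc m} ι xs = cong (Vec.lookup xs (ι zero) ∷_) (values-projections (ι ∘ suc) xs)

rest : ∀ j {n} → Computables (j + n) n
rest j = projections (j ↑ʳ_)

values-rest : ∀ {j n} (ys : Vec ℕ j) (xs : Vec ℕ n) → values (rest j) (ys Vec.++ xs) ≡ xs
values-rest {j} ys xs = begin
  values (rest j) (ys Vec.++ xs)                     ≡⟨ values-projections (j ↑ʳ_) (ys Vec.++ xs) ⟩
  Vec.tabulate (Vec.lookup (ys Vec.++ xs) ∘ (j ↑ʳ_)) ≡⟨ tabulate-cong (lookup-++ʳ ys xs) ⟩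
  Vec.tabulate (Vec.lookup xs)                       ≡⟨ tabulate∘lookup xs ⟩
  xs                                                 ∎
  where open ≡-Reasoning

weaken : ∀ {n} {F : Vec ℕ n → ℕ} → Computable n F → Computable (suc n) (λ xs → F (Vec.tail xs))
weaken {F = F} f = Computable-resp (λ { (x ∷ xs) → cong F (values-rest (x ∷ []) xs) }) (compose f (rest 1))

ignoreSecond : ∀ {n} {F : Vec ℕ (suc n) → ℕ} → Computable (suc n) F →
        Computable (suc (suc n)) (λ xs → F (Vec.head xs ∷ Vec.tail (Vec.tail xs)))
ignoreSecond {F = F} f =
  Computable-resp (λ { (y ∷ r ∷ xs) → cong (λ v → F (y ∷ v)) (values-rest (y ∷ r ∷ []) xs) })
                  (compose f (arg (# 0) ∷ rest 2))

apply₁ : ∀ {n} f {G : Vec ℕ n → ℕ} → Computable₁ f → Computable n G → Computable n (λ xs → f (G xs))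
apply₁ _ f g = compose f (g ∷ [])

apply₂ : ∀ {n} f {G H : Vec ℕ n → ℕ} → Computable₂ f → Computable n G → Computable n H →
         Computable n (λ xs → f (G xs) (H xs))
apply₂ _ f g h = compose f (g ∷ h ∷ [])

sucᶜ : ∀ {n} {G : Vec ℕ n → ℕ} → Computable n G → Computable n (λ xs → suc (G xs))
sucᶜ = apply₁ suc suc-computable

constᶜ : ∀ {n} c → Computable n (λ _ → c)
constᶜ zero    = zero-computable
constᶜ (suc c) = sucᶜ (constᶜ c)

+-computable : Computable₂ _+_
+-computable = recursion _ (arg (# 0)) (apply₁ suc suc-computable (arg (# 1)))
                 (λ { (y ∷ []) → refl }) (λ { x (y ∷ []) → refl })

*-computable : Computable₂ _*_
*-computable = recursion _ zero-computable (apply₂ _+_ +-computable (arg (# 2)) (arg (# 1)))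
                 (λ { (y ∷ []) → refl }) (λ { x (y ∷ []) → refl })

pred-computable : Computable₁ pred
pred-computable = recursion _ zero-computable (arg (# 0)) (λ { [] → refl }) (λ { x [] → refl })

∸-flipped-computable : Computable 2 (λ xs → Vec.lookup xs (suc zero) ∸ Vec.lookup xs zero)
∸-flipped-computable = recursion _ (arg (# 0)) (apply₁ pred pred-computable (arg (# 1)))
                         (λ { (x ∷ []) → refl })
                         (λ { y (x ∷ []) → sym (pred[m∸n]≡m∸[1+n] x y) })

infixl 6 _+ᶜ_ _∸ᶜ_
infixl 7 _*ᶜ_

_+ᶜ_ : ∀ {n} {G H : Vec ℕ n → ℕ} → Computable n G → Computable n H → Computable n (λ xs → G xs + H xs)
_+ᶜ_ = apply₂ _+_ +-computable

_*ᶜ_ : ∀ {n} {G H : Vec ℕ n → ℕ} → Computable n G → Computable n H → Computable n (λ xs → G xs * H xs)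
_*ᶜ_ = apply₂ _*_ *-computable

_∸ᶜ_ : ∀ {n} {G H : Vec ℕ n → ℕ} → Computable n G → Computable n H → Computable n (λ xs → G xs ∸ H xs)
g ∸ᶜ h = compose ∸-flipped-computable (h ∷ g ∷ [])

predᶜ : ∀ {n} {G : Vec ℕ n → ℕ} → Computable n G → Computable n (λ xs → pred (G xs))
predᶜ = apply₁ pred pred-computable

iterate : (ℕ → ℕ) → ℕ → ℕ → ℕ
iterate f zero    x = x
iterate f (suc t) x = f (iterate f t x)

iterate-suc : ∀ f t x → iterate f (suc t) x ≡ iterate f t (f x)
iterate-suc f zero    x = refl
iterate-suc f (suc t) x = cong f (iterate-suc f t x)

iterateᶜ : ∀ {n} f {N X : Vec ℕ n → ℕ} → Computable₁ f → Computable n N → Computable n X →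
           Computable n (λ xs → iterate f (N xs) (X xs))
iterateᶜ f c t x = apply₂ (iterate f) (recursion _ (arg (# 0)) (apply₁ f c (arg (# 1)))
                           (λ { (x ∷ []) → refl }) (λ { t (x ∷ []) → refl })) t x

-- Computable predicates and bounded search

χ : Bool → ℕ
χ b = if b then 1 else 0

T-not⁺ : ∀ {b} → ¬ T b → T (not b)
T-not⁺ {false} _  = _
T-not⁺ {true}  ¬t = ¬t _

T-not⁻ : ∀ {b} → T (not b) → ¬ T b
T-not⁻ {false} _ ()

ComputablePred : (n : ℕ) → (Vec ℕ n → Bool) → Set
ComputablePred n P = Computable n (λ xs → χ (P xs))

isZero-computable : ComputablePred 1 (λ xs → Vec.lookup xs zero ≡ᵇ 0)
isZero-computable = recursion _ (constᶜ 1) zero-computable (λ { [] → refl }) (λ { y [] → refl })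

notᶜ : ∀ {n} {P : Vec ℕ n → Bool} → ComputablePred n P → ComputablePred n (λ xs → not (P xs))
notᶜ {P = P} p = Computable-resp (χ-not ∘ P) (constᶜ 1 ∸ᶜ p)
  where
  χ-not : ∀ b → 1 ∸ χ b ≡ χ (not b)
  χ-not false = refl
  χ-not true  = refl

infixr 6 _∧ᶜ_

_∧ᶜ_ : ∀ {n} {P Q : Vec ℕ n → Bool} → ComputablePred n P → ComputablePred n Q →
       ComputablePred n (λ xs → P xs ∧ Q xs)
_∧ᶜ_ {P = P} {Q} p q = Computable-resp (λ xs → χ-∧ (P xs) (Q xs)) (p *ᶜ q)
  where
  χ-∧ : ∀ a b → χ a * χ b ≡ χ (a ∧ b)
  χ-∧ false b = refl
  χ-∧ true  b = +-identityʳ (χ b)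

infix 4 _≡ᵇᶜ_ _<ᵇᶜ_

_≡ᵇᶜ_ : ∀ {n} {G H : Vec ℕ n → ℕ} → Computable n G → Computable n H →
        ComputablePred n (λ xs → G xs ≡ᵇ H xs)
_≡ᵇᶜ_ {G = G} {H} g h = Computable-resp (λ xs → distance-zero (G xs) (H xs))
                                         (apply₁ (λ x → χ (x ≡ᵇ 0)) isZero-computable ((g ∸ᶜ h) +ᶜ (h ∸ᶜ g)))
  where
  distance-zero : ∀ x y → χ ((x ∸ y) + (y ∸ x) ≡ᵇ 0) ≡ χ (x ≡ᵇ y)
  distance-zero zero    zero    = refl
  distance-zero zero    (suc y) = refl
  distance-zero (suc x) zero    = refl
  distance-zero (suc x) (suc y) = distance-zero x y

_<ᵇᶜ_ : ∀ {n} {G H : Vec ℕ n → ℕ} → Computable n G → Computable n H →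
        ComputablePred n (λ xs → G xs <ᵇ H xs)
_<ᵇᶜ_ {G = G} {H} g h = Computable-resp (λ xs → difference-positive (G xs) (H xs))
                                         (notᶜ (apply₁ (λ x → χ (x ≡ᵇ 0)) isZero-computable (h ∸ᶜ g)))
  where
  difference-positive : ∀ x y → χ (not (y ∸ x ≡ᵇ 0)) ≡ χ (x <ᵇ y)
  difference-positive zero    zero    = refl
  difference-positive zero    (suc y) = refl
  difference-positive (suc x) zero    = refl
  difference-positive (suc x) (suc y) = difference-positive x y

least : (ℕ → Bool) → ℕ → ℕ
least p zero    = zero
least p (suc n) = if (least p n ≡ᵇ n) ∧ not (p n) then suc (least p n) else least p n

least-≤ : ∀ p n → least p n ≤ n
least-≤ p zero = z≤n
least-≤ p (suc n) with (least p n ≡ᵇ n) ∧ not (p n)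
... | true  = s≤s (least-≤ p n)
... | false = m≤n⇒m≤1+n (least-≤ p n)

least-found : ∀ p n → least p n < n → T (p (least p n))
least-found p (suc n) lt with least p n ≡ᵇ n in eq | p n in pn
... | false | _     = least-found p n (≤∧≢⇒< (least-≤ p n) (λ e → subst T eq (≡⇒≡ᵇ _ _ e)))
... | true  | true  = subst (λ m → T (p m)) (sym (≡ᵇ⇒≡ _ _ (subst T (sym eq) _))) (subst T (sym pn) _)
... | true  | false = ⊥-elim (<-irrefl (cong suc (≡ᵇ⇒≡ _ _ (subst T (sym eq) _))) lt)

least-minimal : ∀ p n t → t < least p n → ¬ T (p t)
least-minimal p (suc n) t lt with least p n ≡ᵇ n in eq | p n in pn
... | false | _     = least-minimal p n t lt
... | true  | true  = least-minimal p n t lt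
... | true  | false with m≤n⇒m<n∨m≡n (s≤s⁻¹ lt)
...   | inj₁ t<least = least-minimal p n t t<least
...   | inj₂ refl    = λ pt → subst T (trans (cong p (≡ᵇ⇒≡ _ _ (subst T (sym eq) _))) pn) pt

least-≤-witness : ∀ p n {t} → T (p t) → least p n ≤ t
least-≤-witness p n {t} pt with least p n ≤? t
... | yes le = le
... | no  nle = ⊥-elim (least-minimal p n t (≰⇒> nle) pt)

least-satisfies : ∀ p n {t} → T (p t) → t ≤ n → T (p (least p n))
least-satisfies p n {t} pt t≤n with m≤n⇒m<n∨m≡n (least-≤ p n)
... | inj₁ lt   = least-found p n lt
... | inj₂ l≡n  = subst (T ∘ p) (≤-antisym (≤-trans t≤n (≤-reflexive (sym l≡n))) (least-≤-witness p n pt)) pt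

least-≡ : ∀ p n {t} → T (p t) → t ≤ n → (∀ u → u < t → ¬ T (p u)) → least p n ≡ t
least-≡ p n pt t≤n below =
  ≤-antisym (least-≤-witness p n pt) (≮⇒≥ (λ lt → below _ lt (least-satisfies p n pt t≤n)))

leastᶜ : ∀ {n} {P : Vec ℕ (suc n) → Bool} {B : Vec ℕ n → ℕ} → ComputablePred (suc n) P → Computable n B →
         Computable n (λ xs → least (λ t → P (t ∷ xs)) (B xs))
leastᶜ {n} {P} {B} p b =
  Computable-resp (λ xs → cong (λ v → least (λ t → P (t ∷ v)) (B xs)) (values-rest [] xs))
                  (compose leastUpTo (b ∷ rest 0))
  where
  bump : ∀ c r → (if c then suc r else r) ≡ r + χ c
  bump false r = sym (+-identityʳ r)
  bump true  r = sym (+-comm r 1)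

  leastUpTo : Computable (suc n) (λ xs → least (λ t → P (t ∷ Vec.tail xs)) (Vec.head xs))
  leastUpTo = recursion _ zero-computable (arg (# 1) +ᶜ ((arg (# 1) ≡ᵇᶜ arg (# 0)) ∧ᶜ notᶜ (ignoreSecond p)))
                (λ _ → refl) (λ t xs → let r = least (λ u → P (u ∷ xs)) t in bump ((r ≡ᵇ t) ∧ not (P (t ∷ xs))) r)

anyBelow : (ℕ → Bool) → ℕ → Bool
anyBelow p n = least p n <ᵇ n

anyBelow⁺ : ∀ p n {t} → t < n → T (p t) → T (anyBelow p n)
anyBelow⁺ p n t<n pt = <⇒<ᵇ (≤-<-trans (least-≤-witness p n pt) t<n)

anyBelow⁻ : ∀ p n → T (anyBelow p n) → ∃ λ t → t < n × T (p t)
anyBelow⁻ p n any = least p n , <ᵇ⇒< _ _ any , least-found p n (<ᵇ⇒< _ _ any)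

anyBelowᶜ : ∀ {n} {P : Vec ℕ (suc n) → Bool} {B : Vec ℕ n → ℕ} → ComputablePred (suc n) P → Computable n B →
            ComputablePred n (λ xs → anyBelow (λ t → P (t ∷ xs)) (B xs))
anyBelowᶜ p b = leastᶜ p b <ᵇᶜ b

-- Stagewise approximation of oracle computations

Eventually : (ℕ → Set) → Set
Eventually P = ∃ λ s₀ → ∀ s → s₀ ≤ s → P s

eventually-map : ∀ {P Q : ℕ → Set} → (∀ {s} → P s → Q s) → Eventually P → Eventually Q
eventually-map f (s₀ , p) = s₀ , λ s le → f (p s le)

eventually-× : ∀ {P Q : ℕ → Set} → Eventually P → Eventually Q → Eventually (λ s → P s × Q s)
eventually-× (a , p) (b , q) = a ⊔ b , λ s le → p s (≤-trans (m≤m⊔n a b) le) , q s (≤-trans (m≤n⊔m a b) le)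

eventually-∀< : ∀ {P : ℕ → ℕ → Set} n → (∀ u → u < n → Eventually (P u)) → Eventually (λ s → ∀ u → u < n → P u s)
eventually-∀< zero    ev = 0 , λ _ _ _ ()
eventually-∀< {P} (suc n) ev =
  eventually-map extend (eventually-× (eventually-∀< n (λ u u<n → ev u (m≤n⇒m≤1+n u<n))) (ev n ≤-refl))
  where
  extend : ∀ {s} → (∀ u → u < n → P u s) × P n s → ∀ u → u < suc n → P u s
  extend (below , at-n) u u<1+n with m≤n⇒m<n∨m≡n (s≤s⁻¹ u<1+n)
  ... | inj₁ u<n  = below u u<n
  ... | inj₂ refl = at-n

Eventually-∀ : Set → Set₁
Eventually-∀ A = ∀ {P : A → ℕ → Set} → (∀ a → Eventually (P a)) → Eventually (λ s → ∀ a → P a s)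

Bool-eventually-∀ : Eventually-∀ Bool
Bool-eventually-∀ ev = eventually-map (λ { (f , t) → λ { false → f ; true → t } }) (eventually-× (ev false) (ev true))

Fin-eventually-∀ : ∀ n → Eventually-∀ (Fin n)
Fin-eventually-∀ zero    ev = 0 , λ _ _ ()
Fin-eventually-∀ (suc n) ev =
  eventually-map (λ { (z , s) → λ { zero → z ; (suc i) → s i } }) (eventually-× (ev zero) (Fin-eventually-∀ n (ev ∘ suc)))

words-eventually-∀ : ∀ {A} → Eventually-∀ A → ∀ m {P : List A → ℕ → Set} →
                     (∀ w → length w ≡ m → Eventually (P w)) → Eventually (λ s → ∀ w → length w ≡ m → P w s)
words-eventually-∀ all-A zero    ev = eventually-map (λ { p [] _ → p }) (ev [] refl)
words-eventually-∀ all-A (suc m) ev =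
  eventually-map (λ { p (a ∷ w) len → p a w (suc-injective len) })
    (all-A (λ a → words-eventually-∀ all-A m (λ w len → ev (a ∷ w) (cong suc len))))

_when_ : ℕ → Bool → ℕ
x when b = if b then x else 0

whenᶜ : ∀ {n} {G : Vec ℕ n → ℕ} {P : Vec ℕ n → Bool} → Computable n G → ComputablePred n P →
        Computable n (λ xs → G xs when P xs)
whenᶜ {G = G} {P} g p = Computable-resp (λ xs → χ-* (P xs) (G xs)) (p *ᶜ g)
  where
  χ-* : ∀ b x → χ b * x ≡ x when b
  χ-* false x = refl
  χ-* true  x = +-identityʳ x

allPositive : ∀ {m} → Vec ℕ m → Bool
allPositive []       = true
allPositive (r ∷ rs) = (0 <ᵇ r) ∧ allPositive rs

-- the state of a μ-search after the arguments below z: 0 if their values are all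
-- positive, 1 if one of them has no value yet, suc (suc y) if y is the first zero
searchStep : ℕ → ℕ → ℕ → ℕ
searchStep zero    zero          z = 1
searchStep zero    (suc zero)    z = suc (suc z)
searchStep zero    (suc (suc _)) z = 0
searchStep (suc a) _             z = suc a

searchStepᶜ : Computable 3 (λ xs → searchStep (Vec.lookup xs zero) (Vec.lookup xs (suc zero)) (Vec.lookup xs (suc (suc zero))))
searchStepᶜ = Computable-resp (λ { (a ∷ r ∷ z ∷ []) → arithmetic a r z })
  (arg (# 0) +ᶜ (arg (# 0) ≡ᵇᶜ constᶜ 0)
                *ᶜ ((arg (# 1) ≡ᵇᶜ constᶜ 0) +ᶜ (arg (# 1) ≡ᵇᶜ constᶜ 1) *ᶜ (arg (# 2) +ᶜ constᶜ 2)))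
  where
  arithmetic : ∀ a r z → a + χ (a ≡ᵇ 0) * (χ (r ≡ᵇ 0) + χ (r ≡ᵇ 1) * (z + 2)) ≡ searchStep a r z
  arithmetic (suc a) r             z = +-identityʳ (suc a)
  arithmetic zero    zero          z = refl
  arithmetic zero    (suc zero)    z = trans (+-identityʳ (z + 2 + 0)) (trans (+-identityʳ (z + 2)) (+-comm z 2))
  arithmetic zero    (suc (suc r)) z = refl

-- approx c s xs is 0 if the evaluation of c at stage s has no value yet, and suc v if it
-- yields v; at stage s the oracle o answers x by oracle o (s ∷ x ∷ []).
module Approximation {O : Set} (oracle : O → Vec ℕ 2 → ℕ) (oracleᶜ : ∀ o → Computable 2 (oracle o)) where

  mutual
    approx : ∀ {n} → Code O n → ℕ → Vec ℕ n → ℕ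
    approx zer         s xs       = 1
    approx succ        s (x ∷ []) = suc (suc x)
    approx (proj i)    s xs       = suc (Vec.lookup xs i)
    approx (comp f gs) s xs       = approx f s (Vec.map pred (approxAll gs s xs)) when allPositive (approxAll gs s xs)
    approx (prec g h)  s (y ∷ xs) = approxRec g h s y xs
    approx (mu f)      s xs       = search f s s xs ∸ 1
    approx (orc o)     s (x ∷ []) = suc (oracle o (s ∷ x ∷ []))

    approxAll : ∀ {m n} → Vec (Code O n) m → ℕ → Vec ℕ n → Vec ℕ m
    approxAll []       s xs = []
    approxAll (g ∷ gs) s xs = approx g s xs ∷ approxAll gs s xs

    approxRec : ∀ {n} → Code O n → Code O (suc (suc n)) → ℕ → ℕ → Vec ℕ n → ℕ
    approxRec g h s zero    xs = approx g s xs
    approxRec g h s (suc y) xs = approx h s (y ∷ pred (approxRec g h s y xs) ∷ xs) when (0 <ᵇ approxRec g h s y xs)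

    search : ∀ {n} → Code O (suc n) → ℕ → ℕ → Vec ℕ n → ℕ
    search f s zero    xs = 0
    search f s (suc z) xs = searchStep (search f s z xs) (approx f s (z ∷ xs)) z

  mutual
    approxᶜ : ∀ {n} (c : Code O n) → Computable (suc n) (λ v → approx c (Vec.head v) (Vec.tail v))
    approxᶜ zer        = constᶜ 1
    approxᶜ succ       = Computable-resp (λ { (s ∷ x ∷ []) → refl }) (sucᶜ (sucᶜ (arg (# 1))))
    approxᶜ (proj i)   = Computable-resp (λ { (s ∷ xs) → refl }) (sucᶜ (arg (suc i)))
    approxᶜ (orc o)    = Computable-resp (λ { (s ∷ x ∷ []) → refl }) (sucᶜ (oracleᶜ o))
    approxᶜ (comp f gs) =
      Computable-resp (λ { (s ∷ xs) → cong (λ w → approx f s w when allPositive (approxAll gs s xs)) (values-predAll gs s xs) })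
                      (whenᶜ (compose (approxᶜ f) (arg (# 0) ∷ predAllᶜ gs)) (allPositiveᶜ gs))
    approxᶜ {suc n} (prec g h) =
      Computable-resp (λ { (s ∷ y ∷ xs) → cong (approxRec g h s y) (values-rest (s ∷ y ∷ []) xs) })
                      (compose recᶜ (arg (# 1) ∷ arg (# 0) ∷ rest 2))
      where
      recᶜ : Computable (suc (suc n)) (λ v → approxRec g h (Vec.head (Vec.tail v)) (Vec.head v) (Vec.tail (Vec.tail v)))
      recᶜ = recursion _ (approxᶜ g)
               (whenᶜ (compose (approxᶜ h) (arg (# 2) ∷ arg (# 0) ∷ predᶜ (arg (# 1)) ∷ rest 3))
                      (constᶜ 0 <ᵇᶜ arg (# 1)))
               (λ _ → refl)
               (λ { y (s ∷ xs) → let r = approxRec g h s y xs in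
                   cong (λ w → approx h s (y ∷ pred r ∷ w) when (0 <ᵇ r)) (sym (values-rest (y ∷ r ∷ s ∷ []) xs)) })
    approxᶜ {n} (mu f) =
      Computable-resp (λ { (s ∷ xs) → cong (λ w → search f s s w ∸ 1) (values-rest (s ∷ []) xs) })
                      (compose searchᶜ (arg (# 0) ∷ arg (# 0) ∷ rest 1) ∸ᶜ constᶜ 1)
      where
      searchᶜ : Computable (suc (suc n)) (λ v → search f (Vec.head (Vec.tail v)) (Vec.head v) (Vec.tail (Vec.tail v)))
      searchᶜ = recursion _ zero-computable
                  (compose searchStepᶜ (arg (# 1) ∷ compose (approxᶜ f) (arg (# 2) ∷ arg (# 0) ∷ rest 3) ∷ arg (# 0) ∷ []))
                  (λ _ → refl)
                  (λ { z (s ∷ xs) → let a = search f s z xs in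
                      cong (λ w → searchStep a (approx f s (z ∷ w)) z) (sym (values-rest (z ∷ a ∷ s ∷ []) xs)) })

    allPositiveᶜ : ∀ {m n} (gs : Vec (Code O n) m) → ComputablePred (suc n) (λ v → allPositive (approxAll gs (Vec.head v) (Vec.tail v)))
    allPositiveᶜ []       = constᶜ 1
    allPositiveᶜ (g ∷ gs) = (constᶜ 0 <ᵇᶜ approxᶜ g) ∧ᶜ allPositiveᶜ gs

    predAllᶜ : ∀ {m n} → Vec (Code O n) m → Computables (suc n) m
    predAllᶜ []       = []
    predAllᶜ (g ∷ gs) = predᶜ (approxᶜ g) ∷ predAllᶜ gs

    values-predAll : ∀ {m n} (gs : Vec (Code O n) m) s xs → values (predAllᶜ gs) (s ∷ xs) ≡ Vec.map pred (approxAll gs s xs)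
    values-predAll []       s xs = refl
    values-predAll (g ∷ gs) s xs = cong (pred (approx g s xs) ∷_) (values-predAll gs s xs)

  PositiveBelow : ∀ {n} → Code O (suc n) → ℕ → Vec ℕ n → ℕ → Set
  PositiveBelow f s xs y = ∀ u → u < y → ∃ λ w → approx f s (u ∷ xs) ≡ suc (suc w)

  search-zero : ∀ {n} (f : Code O (suc n)) s z xs → search f s z xs ≡ 0 → PositiveBelow f s xs z
  search-zero f s (suc z) xs eq u u<1+z with search f s z xs in e₁ | approx f s (z ∷ xs) in e₂ | eq
  ... | zero  | zero        | ()
  ... | zero  | suc zero    | ()
  ... | suc _ | _           | ()
  ... | zero  | suc (suc w) | _ with m≤n⇒m<n∨m≡n (s≤s⁻¹ u<1+z)
  ...   | inj₁ u<z  = search-zero f s z xs e₁ u u<z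
  ...   | inj₂ refl = w , e₂

  search-found : ∀ {n} (f : Code O (suc n)) s z xs y → search f s z xs ≡ suc (suc y) →
                 y < z × approx f s (y ∷ xs) ≡ 1 × PositiveBelow f s xs y
  search-found f s (suc z) xs y eq with search f s z xs in e₁ | approx f s (z ∷ xs) in e₂ | eq
  ... | zero        | zero        | ()
  ... | zero        | suc (suc _) | ()
  ... | suc zero    | _           | ()
  ... | zero        | suc zero    | refl = ≤-refl , e₂ , search-zero f s z xs e₁
  ... | suc (suc _) | _           | refl with search-found f s z xs y e₁
  ...   | y<z , hit , below = m≤n⇒m≤1+n y<z , hit , below

  search-before : ∀ {n} (f : Code O (suc n)) s xs y → PositiveBelow f s xs y → ∀ z → z ≤ y → search f s z xs ≡ 0
  search-before f s xs y below zero    _   = refl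
  search-before f s xs y below (suc z) z<y with below z z<y
  ... | w , e rewrite search-before f s xs y below z (<⇒≤ z<y) | e = refl

  search-after : ∀ {n} (f : Code O (suc n)) s xs y → PositiveBelow f s xs y → approx f s (y ∷ xs) ≡ 1 →
                 ∀ z → y < z → search f s z xs ≡ suc (suc y)
  search-after f s xs y below hit (suc z) (s≤s y≤z) with m≤n⇒m<n∨m≡n y≤z
  ... | inj₁ y<z  rewrite search-after f s xs y below hit z y<z = refl
  ... | inj₂ refl rewrite search-before f s xs y below y ≤-refl | hit = refl

  module Soundness (R : O → ℕ → ℕ → Set) (oracle-sound : ∀ o s x v → oracle o (s ∷ x ∷ []) ≡ v → R o x v) where
    open Evaluation R

    mutual
      approx-sound : ∀ {n} (c : Code O n) s xs v → approx c s xs ≡ suc v → Eval c xs v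
      approx-sound zer        s xs       _ refl = e-zer
      approx-sound succ       s (x ∷ []) _ refl = e-succ
      approx-sound (proj i)   s xs       _ refl = e-proj
      approx-sound (orc o)    s (x ∷ []) v e    = e-orc (oracle-sound o s x v (suc-injective e))
      approx-sound (prec g h) s (y ∷ xs) v e    = approxRec-sound g h s y xs v e
      approx-sound (comp f gs) s xs v e with allPositive (approxAll gs s xs) in pos | e
      ... | true  | e′ = e-comp (approxAll-sound gs s xs pos) (approx-sound f s _ v e′)
      ... | false | ()
      approx-sound (mu f) s xs v e with search f s s xs in found | e
      ... | zero        | ()
      ... | suc zero    | ()
      ... | suc (suc y) | refl with search-found f s s xs y found
      ...   | _ , hit , below =
        e-mu (approx-sound f s (y ∷ xs) 0 hit)
             (λ u u<y → let (w , ew) = below u u<y in w , approx-sound f s (u ∷ xs) (suc w) ew)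

      approxAll-sound : ∀ {m n} (gs : Vec (Code O n) m) s xs → allPositive (approxAll gs s xs) ≡ true →
                        EvalAll gs xs (Vec.map pred (approxAll gs s xs))
      approxAll-sound []       s xs _ = []
      approxAll-sound (g ∷ gs) s xs pos with approx g s xs in e | pos
      ... | zero  | ()
      ... | suc r | pos′ = approx-sound g s xs r e ∷ approxAll-sound gs s xs pos′

      approxRec-sound : ∀ {n} (g : Code O n) h s y xs v → approxRec g h s y xs ≡ suc v → Eval (prec g h) (y ∷ xs) v
      approxRec-sound g h s zero    xs v e = e-prec0 (approx-sound g s xs v e)
      approxRec-sound g h s (suc y) xs v e with approxRec g h s y xs in r | e
      ... | zero  | ()
      ... | suc w | e′ = e-precS (approxRec-sound g h s y xs w r) (approx-sound h s _ v e′)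

  module Completeness (R : O → ℕ → ℕ → Set)
                      (oracle-converges : ∀ o x v → R o x v → Eventually (λ s → oracle o (s ∷ x ∷ []) ≡ v)) where
    open Evaluation R

    allPositive-map-suc : ∀ {m} (ys : Vec ℕ m) → allPositive (Vec.map suc ys) ≡ true
    allPositive-map-suc []       = refl
    allPositive-map-suc (y ∷ ys) = allPositive-map-suc ys

    mutual
      approx-complete : ∀ {n} {c : Code O n} {xs v} → Eval c xs v → Eventually (λ s → approx c s xs ≡ suc v)
      approx-complete e-zer       = 0 , λ _ _ → refl
      approx-complete e-succ      = 0 , λ _ _ → refl
      approx-complete e-proj      = 0 , λ _ _ → refl
      approx-complete (e-orc r)   = eventually-map (cong suc) (oracle-converges _ _ _ r)
      approx-complete (e-prec0 d) = approx-complete d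
      approx-complete (e-precS {h = h} {xs = xs} {y = y} d₁ d₂) =
        eventually-map (λ { {s} (r≡ , h≡) → trans (cong (λ r → approx h s (y ∷ pred r ∷ xs) when (0 <ᵇ r)) r≡) h≡ })
                       (eventually-× (approx-complete d₁) (approx-complete d₂))
      approx-complete (e-comp {f = f} {gs} {xs} {ys} {v} ds d) =
        eventually-map combine (eventually-× (approxAll-complete ds) (approx-complete d))
        where
        combine : ∀ {s} → approxAll gs s xs ≡ Vec.map suc ys × approx f s ys ≡ suc v → approx (comp f gs) s xs ≡ suc v
        combine (all≡ , f≡) rewrite all≡ | allPositive-map-suc ys | sym (map-∘ pred suc ys) | map-id ys = f≡
      approx-complete (e-mu {f = f} {xs} {y} d below) =
        eventually-map combine
          (eventually-× (eventually-× (approx-complete d) (eventually-∀< y positive)) (suc y , λ _ le → le))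
        where
        positive : ∀ u → u < y → Eventually (λ s → ∃ λ w → approx f s (u ∷ xs) ≡ suc (suc w))
        positive u u<y = let (w , ev) = below u u<y in eventually-map (w ,_) (approx-complete ev)
        combine : ∀ {s} → (approx f s (y ∷ xs) ≡ 1 × PositiveBelow f s xs y) × y < s → approx (mu f) s xs ≡ suc y
        combine {s} ((hit , pos) , y<s) rewrite search-after f s xs y pos hit s y<s = refl

      approxAll-complete : ∀ {m n} {gs : Vec (Code O n) m} {xs ys} → EvalAll gs xs ys →
                           Eventually (λ s → approxAll gs s xs ≡ Vec.map suc ys)
      approxAll-complete []       = 0 , λ _ _ → refl
      approxAll-complete (d ∷ ds) =
        eventually-map (λ { (a , b) → cong₂ _∷_ a b }) (eventually-× (approx-complete d) (approxAll-complete ds))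

module Plain = Approximation {⊥} (λ ()) (λ ())

haltsBy : PCode 1 → Vec ℕ 2 → ℕ
haltsBy d (s ∷ x ∷ []) = χ (0 <ᵇ Plain.approx d s (x ∷ []))

haltsByᶜ : ∀ d → Computable 2 (haltsBy d)
haltsByᶜ d = Computable-resp (λ { (s ∷ x ∷ []) → refl }) (constᶜ 0 <ᵇᶜ Plain.approxᶜ d)

module Jump = Approximation haltsBy haltsByᶜ

haltsBy-converges : ∀ d x v → jumpOracle d x v → Eventually (λ s → haltsBy d (s ∷ x ∷ []) ≡ v)
haltsBy-converges d x .1 (inj₁ (refl , w , halts)) =
  eventually-map (λ e → cong (χ ∘ (0 <ᵇ_)) e) (Plain.Completeness.approx-complete noOracle (λ ()) halts)
haltsBy-converges d x .0 (inj₂ (refl , ¬halts)) = 0 , λ s _ → undefined s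
  where
  undefined : ∀ s → haltsBy d (s ∷ x ∷ []) ≡ 0
  undefined s with Plain.approx d s (x ∷ []) in e
  ... | zero  = refl
  ... | suc w = ⊥-elim (¬halts (w , Plain.Soundness.approx-sound noOracle (λ ()) d s (x ∷ []) w e))

Δ⁰₂-approximation : ∀ {n} {c : JCode n} {xs v} → JEval c xs v → Eventually (λ s → Jump.approx c s xs ≡ suc v)
Δ⁰₂-approximation = Jump.Completeness.approx-complete jumpOracle haltsBy-converges

-- Decoding strings and tuples

parityBit : ℕ → ℕ
parityBit zero    = 0
parityBit (suc n) = 1 ∸ parityBit n

parityBit-2* : ∀ n → parityBit (2 * n) ≡ 0
parityBit-2* zero    = refl
parityBit-2* (suc n) rewrite +-suc n (n + 0) = cong (λ p → 1 ∸ (1 ∸ p)) (parityBit-2* n)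

parityBit-1+2* : ∀ n → parityBit (suc (2 * n)) ≡ 1
parityBit-1+2* n = cong (1 ∸_) (parityBit-2* n)

⌊suc/2⌋ : ∀ n → ⌊ suc n /2⌋ ≡ ⌊ n /2⌋ + parityBit n
⌊suc/2⌋ zero    = refl
⌊suc/2⌋ (suc n) = sym $ begin
  ⌊ suc n /2⌋ + (1 ∸ parityBit n)              ≡⟨ cong (_+ (1 ∸ parityBit n)) (⌊suc/2⌋ n) ⟩
  ⌊ n /2⌋ + parityBit n + (1 ∸ parityBit n)    ≡⟨ +-assoc ⌊ n /2⌋ (parityBit n) _ ⟩
  ⌊ n /2⌋ + (parityBit n + (1 ∸ parityBit n))  ≡⟨ cong (⌊ n /2⌋ +_) (m+[n∸m]≡n (parityBit≤1 n)) ⟩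
  ⌊ n /2⌋ + 1                                  ≡⟨ +-comm ⌊ n /2⌋ 1 ⟩
  suc ⌊ n /2⌋                                  ∎
  where
  open ≡-Reasoning
  parityBit≤1 : ∀ n → parityBit n ≤ 1
  parityBit≤1 zero    = z≤n
  parityBit≤1 (suc n) = m∸n≤m 1 (parityBit n)

⌊2*n/2⌋ : ∀ n → ⌊ 2 * n /2⌋ ≡ n
⌊2*n/2⌋ n = trans (cong (λ m → ⌊ n + m /2⌋) (+-identityʳ n)) (sym (n≡⌊n+n/2⌋ n))

⌊1+2*n/2⌋ : ∀ n → ⌊ suc (2 * n) /2⌋ ≡ n
⌊1+2*n/2⌋ n = trans (⌊suc/2⌋ (2 * n)) (trans (cong₂ _+_ (⌊2*n/2⌋ n) (parityBit-2* n)) (+-identityʳ n))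

parityBitᶜ : ∀ {n} {G : Vec ℕ n → ℕ} → Computable n G → Computable n (λ xs → parityBit (G xs))
parityBitᶜ = apply₁ parityBit (recursion _ zero-computable (constᶜ 1 ∸ᶜ arg (# 1))
                           (λ { [] → refl }) (λ { n [] → refl }))

⌊_/2⌋ᶜ : ∀ {n} {G : Vec ℕ n → ℕ} → Computable n G → Computable n (λ xs → ⌊ G xs /2⌋)
⌊_/2⌋ᶜ = apply₁ ⌊_/2⌋ (recursion _ zero-computable (arg (# 1) +ᶜ parityBitᶜ (arg (# 0)))
                          (λ { [] → refl }) (λ { n [] → ⌊suc/2⌋ n }))

2^ᶜ : ∀ {n} {G : Vec ℕ n → ℕ} → Computable n G → Computable n (λ xs → 2 ^ G xs)
2^ᶜ {G = G} g = Computable-resp (λ xs → doublings (G xs)) (iterateᶜ (2 *_) (constᶜ 2 *ᶜ arg (# 0)) g (constᶜ 1))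
  where
  doublings : ∀ a → iterate (2 *_) a 1 ≡ 2 ^ a
  doublings zero    = refl
  doublings (suc a) = cong (2 *_) (doublings a)

n<2^n : ∀ n → n < 2 ^ n
n<2^n zero    = z<s
n<2^n (suc n) = +-mono-<-≤ (m^n>0 2 n) (≤-trans (n<2^n n) (m≤m+n (2 ^ n) 0))

tailˢ : ℕ → ℕ
tailˢ x = ⌊ x ∸ 1 /2⌋

dropˢ : ℕ → ℕ → ℕ
dropˢ = iterate tailˢ

lengthˢ : ℕ → ℕ
lengthˢ x = least (λ t → dropˢ t x ≡ᵇ 0) x

takeˢ : ℕ → ℕ → ℕ
takeˢ i x = x ∸ 2 ^ i * dropˢ i x

tailˢ-encStr : ∀ ρ → tailˢ (encStr ρ) ≡ encStr (drop 1 ρ)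
tailˢ-encStr []          = refl
tailˢ-encStr (false ∷ ρ) = ⌊2*n/2⌋ (encStr ρ)
tailˢ-encStr (true ∷ ρ)  = ⌊1+2*n/2⌋ (encStr ρ)

dropˢ-encStr : ∀ t ρ → dropˢ t (encStr ρ) ≡ encStr (drop t ρ)
dropˢ-encStr zero    ρ = refl
dropˢ-encStr (suc t) ρ = begin
  tailˢ (dropˢ t (encStr ρ))   ≡⟨ cong tailˢ (dropˢ-encStr t ρ) ⟩
  tailˢ (encStr (drop t ρ))    ≡⟨ tailˢ-encStr (drop t ρ) ⟩
  encStr (drop 1 (drop t ρ))   ≡⟨ cong encStr (drop-drop t 1 ρ) ⟩
  encStr (drop (t + 1) ρ)      ≡⟨ cong (λ n → encStr (drop n ρ)) (+-comm t 1) ⟩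
  encStr (drop (suc t) ρ)      ∎
  where open ≡-Reasoning

length≤encStr : ∀ ρ → length ρ ≤ encStr ρ
length≤encStr []          = z≤n
length≤encStr (false ∷ ρ) = s≤s (≤-trans (length≤encStr ρ) (m≤m+n _ _))
length≤encStr (true ∷ ρ)  = m≤n⇒m≤1+n (s≤s (≤-trans (length≤encStr ρ) (m≤m+n _ _)))

lengthˢ-encStr : ∀ ρ → lengthˢ (encStr ρ) ≡ length ρ
lengthˢ-encStr ρ = least-≡ _ (encStr ρ) at-length (length≤encStr ρ) below-length
  where
  at-length : T (dropˢ (length ρ) (encStr ρ) ≡ᵇ 0)
  at-length rewrite dropˢ-encStr (length ρ) ρ | drop-all (length ρ) ρ ≤-refl = _
  nonempty-code : ∀ σ → 0 < length σ → ¬ T (encStr σ ≡ᵇ 0)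
  nonempty-code (false ∷ _) _ ()
  nonempty-code (true ∷ _)  _ ()
  below-length : ∀ u → u < length ρ → ¬ T (dropˢ u (encStr ρ) ≡ᵇ 0)
  below-length u u<ℓ rewrite dropˢ-encStr u ρ =
    nonempty-code (drop u ρ) (subst (0 <_) (sym (length-drop u ρ)) (m<n⇒0<n∸m u<ℓ))

double-++ : ∀ u v → encStr (u ++ v) ≡ encStr u + 2 ^ length u * encStr v →
            2 * encStr (u ++ v) ≡ 2 * encStr u + 2 * 2 ^ length u * encStr v
double-++ u v eq = begin
  2 * encStr (u ++ v)                           ≡⟨ cong (2 *_) eq ⟩
  2 * (encStr u + 2 ^ length u * encStr v)      ≡⟨ *-distribˡ-+ 2 (encStr u) _ ⟩
  2 * encStr u + 2 * (2 ^ length u * encStr v)  ≡⟨ cong (2 * encStr u +_) (sym (*-assoc 2 (2 ^ length u) _)) ⟩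
  2 * encStr u + 2 * 2 ^ length u * encStr v    ∎
  where open ≡-Reasoning

encStr-++ : ∀ u v → encStr (u ++ v) ≡ encStr u + 2 ^ length u * encStr v
encStr-++ []          v = sym (+-identityʳ _)
encStr-++ (false ∷ u) v = cong suc (double-++ u v (encStr-++ u v))
encStr-++ (true ∷ u)  v = cong (λ n → suc (suc n)) (double-++ u v (encStr-++ u v))

2^length-take : ∀ i ρ → 2 ^ length (take i ρ) * encStr (drop i ρ) ≡ 2 ^ i * encStr (drop i ρ)
2^length-take zero    ρ       = refl
2^length-take (suc i) []      = sym (*-zeroʳ (2 ^ suc i))
2^length-take (suc i) (b ∷ ρ) = begin
  2 * 2 ^ length (take i ρ) * encStr (drop i ρ)    ≡⟨ *-assoc 2 (2 ^ length (take i ρ)) (encStr (drop i ρ)) ⟩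
  2 * (2 ^ length (take i ρ) * encStr (drop i ρ))  ≡⟨ cong (2 *_) (2^length-take i ρ) ⟩
  2 * (2 ^ i * encStr (drop i ρ))                  ≡⟨ *-assoc 2 (2 ^ i) (encStr (drop i ρ)) ⟨
  2 * 2 ^ i * encStr (drop i ρ)                    ∎
  where open ≡-Reasoning

takeˢ-encStr : ∀ i ρ → takeˢ i (encStr ρ) ≡ encStr (take i ρ)
takeˢ-encStr i ρ = begin
  encStr ρ ∸ 2 ^ i * dropˢ i (encStr ρ)   ≡⟨ cong (λ d → encStr ρ ∸ 2 ^ i * d) (dropˢ-encStr i ρ) ⟩
  encStr ρ ∸ suffix                       ≡⟨ cong (λ σ → encStr σ ∸ suffix) (take++drop≡id i ρ) ⟨
  encStr (take i ρ ++ drop i ρ) ∸ suffix  ≡⟨ cong (_∸ suffix) (encStr-++ (take i ρ) (drop i ρ)) ⟩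
  encStr (take i ρ) + 2 ^ length (take i ρ) * encStr (drop i ρ) ∸ suffix
                                          ≡⟨ cong (λ r → encStr (take i ρ) + r ∸ suffix) (2^length-take i ρ) ⟩
  encStr (take i ρ) + suffix ∸ suffix     ≡⟨ m+n∸n≡m (encStr (take i ρ)) suffix ⟩
  encStr (take i ρ)                       ∎
  where
  open ≡-Reasoning
  suffix : ℕ
  suffix = 2 ^ i * encStr (drop i ρ)

tailˢᶜ : Computable₁ tailˢ
tailˢᶜ = ⌊ arg (# 0) ∸ᶜ constᶜ 1 /2⌋ᶜ

dropˢᶜ : ∀ {n} {I X : Vec ℕ n → ℕ} → Computable n I → Computable n X → Computable n (λ xs → dropˢ (I xs) (X xs))
dropˢᶜ = iterateᶜ tailˢ tailˢᶜ

lengthˢᶜ : ∀ {n} {X : Vec ℕ n → ℕ} → Computable n X → Computable n (λ xs → lengthˢ (X xs))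
lengthˢᶜ x = leastᶜ (dropˢᶜ (arg (# 0)) (weaken x) ≡ᵇᶜ constᶜ 0) x

takeˢᶜ : ∀ {n} {I X : Vec ℕ n → ℕ} → Computable n I → Computable n X → Computable n (λ xs → takeˢ (I xs) (X xs))
takeˢᶜ i x = x ∸ᶜ 2^ᶜ i *ᶜ dropˢᶜ i x

encTuple : ∀ {k} → List (Fin k) → ℕ
encTuple ζ = encList (map toℕ ζ)

encList-∷ : ∀ a l → encList (a ∷ l) ≡ 2 ^ a * suc (2 * encList l)
encList-∷ a l = begin
  suc (2 ^ a * (2 * encList l + 1) ∸ 1)  ≡⟨ cong (λ o → suc (2 ^ a * o ∸ 1)) (+-comm (2 * encList l) 1) ⟩
  suc (2 ^ a * suc (2 * encList l) ∸ 1)  ≡⟨ suc-pred-positive (2 ^ a * suc (2 * encList l)) {{m*n≢0 (2 ^ a) _ {{m^n≢0 2 a}}}} ⟩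
  2 ^ a * suc (2 * encList l)            ∎
  where
  open ≡-Reasoning
  suc-pred-positive : ∀ x .{{_ : NonZero x}} → suc (x ∸ 1) ≡ x
  suc-pred-positive (suc x) = refl

halve-2^ : ∀ e o → ⌊ 2 ^ suc e * o /2⌋ ≡ 2 ^ e * o
halve-2^ e o = trans (cong ⌊_/2⌋ (*-assoc 2 (2 ^ e) o)) (⌊2*n/2⌋ (2 ^ e * o))

halvings : ∀ t c o → iterate ⌊_/2⌋ t (2 ^ (t + c) * o) ≡ 2 ^ c * o
halvings zero    c o = refl
halvings (suc t) c o = begin
  iterate ⌊_/2⌋ (suc t) (2 ^ suc (t + c) * o)  ≡⟨ iterate-suc ⌊_/2⌋ t _ ⟩
  iterate ⌊_/2⌋ t ⌊ 2 ^ suc (t + c) * o /2⌋    ≡⟨ cong (iterate ⌊_/2⌋ t) (halve-2^ (t + c) o) ⟩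
  iterate ⌊_/2⌋ t (2 ^ (t + c) * o)            ≡⟨ halvings t c o ⟩
  2 ^ c * o                                    ∎
  where open ≡-Reasoning

-- encList (a ∷ l) = 2 ^ a * suc (2 * encList l) (encList-∷), so a counts the halvings
-- that make the code odd
headˡ : ℕ → ℕ
headˡ x = least (λ t → parityBit (iterate ⌊_/2⌋ t x) ≡ᵇ 1) x

tailˡ : ℕ → ℕ
tailˡ x = ⌊ iterate ⌊_/2⌋ (headˡ x) x /2⌋

dropˡ : ℕ → ℕ → ℕ
dropˡ = iterate tailˡ

entryˡ : ℕ → ℕ → ℕ
entryˡ j x = headˡ (dropˡ j x)

halvings-all : ∀ a o → iterate ⌊_/2⌋ a (2 ^ a * o) ≡ o
halvings-all a o = begin
  iterate ⌊_/2⌋ a (2 ^ a * o)        ≡⟨ cong (λ e → iterate ⌊_/2⌋ a (2 ^ e * o)) (+-identityʳ a) ⟨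
  iterate ⌊_/2⌋ a (2 ^ (a + 0) * o)  ≡⟨ halvings a 0 o ⟩
  o + 0                              ≡⟨ +-identityʳ o ⟩
  o                                  ∎
  where open ≡-Reasoning

headˡ-2^*odd : ∀ a b → headˡ (2 ^ a * suc (2 * b)) ≡ a
headˡ-2^*odd a b = least-≡ _ _ odd-after-a (≤-trans (<⇒≤ (n<2^n a)) (m≤m*n (2 ^ a) (suc (2 * b)))) even-before-a
  where
  o : ℕ
  o = suc (2 * b)
  odd-after-a : T (parityBit (iterate ⌊_/2⌋ a (2 ^ a * o)) ≡ᵇ 1)
  odd-after-a rewrite halvings-all a o | parityBit-1+2* b = _
  even-before-a : ∀ u → u < a → ¬ T (parityBit (iterate ⌊_/2⌋ u (2 ^ a * o)) ≡ᵇ 1)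
  even-before-a u u<a odd with a ∸ u in eq
  ... | zero  = m>n⇒m∸n≢0 u<a eq
  ... | suc c = 0≢1+n (trans (sym (parityBit-2* (2 ^ c * o))) (≡ᵇ⇒≡ _ _ (subst (λ x → T (parityBit x ≡ᵇ 1)) halved odd)))
    where
    halved : iterate ⌊_/2⌋ u (2 ^ a * o) ≡ 2 * (2 ^ c * o)
    halved = begin
      iterate ⌊_/2⌋ u (2 ^ a * o)              ≡⟨ cong (λ e → iterate ⌊_/2⌋ u (2 ^ e * o))
                                                         (trans (sym (m+[n∸m]≡n (<⇒≤ u<a))) (cong (u +_) eq)) ⟩
      iterate ⌊_/2⌋ u (2 ^ (u + suc c) * o)    ≡⟨ halvings u (suc c) o ⟩
      2 * 2 ^ c * o                            ≡⟨ *-assoc 2 (2 ^ c) o ⟩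
      2 * (2 ^ c * o)                          ∎
      where open ≡-Reasoning

tailˡ-2^*odd : ∀ a b → tailˡ (2 ^ a * suc (2 * b)) ≡ b
tailˡ-2^*odd a b rewrite headˡ-2^*odd a b | halvings-all a (suc (2 * b)) = ⌊1+2*n/2⌋ b

headˡ-encList : ∀ a l → headˡ (encList (a ∷ l)) ≡ a
headˡ-encList a l = trans (cong headˡ (encList-∷ a l)) (headˡ-2^*odd a (encList l))

tailˡ-encList : ∀ l → tailˡ (encList l) ≡ encList (drop 1 l)
tailˡ-encList []      = refl
tailˡ-encList (a ∷ l) = trans (cong tailˡ (encList-∷ a l)) (tailˡ-2^*odd a (encList l))

dropˡ-encList : ∀ j l → dropˡ j (encList l) ≡ encList (drop j l)
dropˡ-encList zero    l = refl
dropˡ-encList (suc j) l = begin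
  tailˡ (dropˡ j (encList l))  ≡⟨ cong tailˡ (dropˡ-encList j l) ⟩
  tailˡ (encList (drop j l))   ≡⟨ tailˡ-encList (drop j l) ⟩
  encList (drop 1 (drop j l))  ≡⟨ cong encList (drop-drop j 1 l) ⟩
  encList (drop (j + 1) l)     ≡⟨ cong (λ n → encList (drop n l)) (+-comm j 1) ⟩
  encList (drop (suc j) l)     ∎
  where open ≡-Reasoning

nth-map : ∀ {A B : Set} (g : A → B) xs i → nth (map g xs) i ≡ Data.Maybe.map g (nth xs i)
nth-map g []       i       = refl
nth-map g (x ∷ xs) zero    = refl
nth-map g (x ∷ xs) (suc i) = nth-map g xs i

nth-drop : ∀ {A : Set} (l : List A) j {a} → nth l j ≡ just a → ∃ λ r → drop j l ≡ a ∷ r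
nth-drop (x ∷ l) zero    refl = l , refl
nth-drop (x ∷ l) (suc j) h    = nth-drop l j h

entryˡ-encTuple : ∀ {k} (ζ : List (Fin k)) j {e} → nth ζ j ≡ just e → entryˡ j (encTuple ζ) ≡ toℕ e
entryˡ-encTuple ζ j h with nth-drop (map toℕ ζ) j (trans (nth-map toℕ ζ j) (cong (Data.Maybe.map toℕ) h))
... | r , eq = trans (cong headˡ (trans (dropˡ-encList j (map toℕ ζ)) (cong encList eq))) (headˡ-encList _ r)

wellFormedˡ : ℕ → ℕ → Bool
wellFormedˡ k y = (y ≡ᵇ 2 ^ headˡ y * suc (2 * tailˡ y)) ∧ (headˡ y <ᵇ k)

isTupleˡ : ℕ → ℕ → ℕ → Bool
isTupleˡ k m x = (dropˡ m x ≡ᵇ 0) ∧ not (anyBelow (λ j → not (wellFormedˡ k (dropˡ j x))) m)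

isTupleˡ⁻ : ∀ k m x → T (isTupleˡ k m x) → dropˡ m x ≡ 0 × (∀ j → j < m → T (wellFormedˡ k (dropˡ j x)))
isTupleˡ⁻ k m x t with Equivalence.to T-∧ t
... | end , none = ≡ᵇ⇒≡ _ _ end , λ j j<m → decidable-stable (T? _) (λ ¬wf → T-not⁻ none (anyBelow⁺ _ m j<m (T-not⁺ ¬wf)))

isTupleˡ⁺ : ∀ k m x → dropˡ m x ≡ 0 → (∀ j → j < m → T (wellFormedˡ k (dropˡ j x))) → T (isTupleˡ k m x)
isTupleˡ⁺ k m x end wf = Equivalence.from T-∧ (≡⇒≡ᵇ _ _ end , T-not⁺ none)
  where
  none : ¬ T (anyBelow (λ j → not (wellFormedˡ k (dropˡ j x))) m)
  none any with anyBelow⁻ _ m any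
  ... | j , j<m , ¬wf = T-not⁻ ¬wf (wf j j<m)

isTupleˡ-decode : ∀ k m x → T (isTupleˡ k m x) → ∃ λ (ζ : List (Fin k)) → length ζ ≡ m × encTuple ζ ≡ x
isTupleˡ-decode k m x t = decode m x (isTupleˡ⁻ k m x t)
  where
  decode : ∀ m x → dropˡ m x ≡ 0 × (∀ j → j < m → T (wellFormedˡ k (dropˡ j x))) →
           ∃ λ (ζ : List (Fin k)) → length ζ ≡ m × encTuple ζ ≡ x
  decode zero    x (end , _)  = [] , refl , sym end
  decode (suc m) x (end , wf) with Equivalence.to T-∧ (wf 0 z<s)
                                 | decode m (tailˡ x) (trans (sym (iterate-suc tailˡ m x)) end ,
                                     λ j j<m → subst (T ∘ wellFormedˡ k) (iterate-suc tailˡ j x) (wf (suc j) (s<s j<m)))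
  ... | shape , head<k | ζ , len , encζ = fromℕ< head<k′ ∷ ζ , cong suc len , encoding
    where
    head<k′ : headˡ x < k
    head<k′ = <ᵇ⇒< _ _ head<k
    encoding : encTuple (fromℕ< head<k′ ∷ ζ) ≡ x
    encoding = begin
      encList (toℕ (fromℕ< head<k′) ∷ map toℕ ζ)       ≡⟨ encList-∷ (toℕ (fromℕ< head<k′)) (map toℕ ζ) ⟩
      2 ^ toℕ (fromℕ< head<k′) * suc (2 * encTuple ζ)  ≡⟨ cong₂ (λ a b → 2 ^ a * suc (2 * b)) (toℕ-fromℕ< head<k′) encζ ⟩
      2 ^ headˡ x * suc (2 * tailˡ x)                  ≡⟨ ≡ᵇ⇒≡ _ _ shape ⟨
      x                                                ∎
      where open ≡-Reasoning

isTupleˡ-encTuple : ∀ {k} (ζ : List (Fin k)) → T (isTupleˡ k (length ζ) (encTuple ζ))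
isTupleˡ-encTuple {k} ζ = isTupleˡ⁺ k (length ζ) (encTuple ζ) end wf
  where
  end : dropˡ (length ζ) (encTuple ζ) ≡ 0
  end rewrite dropˡ-encList (length ζ) (map toℕ ζ) | drop-all (length ζ) (map toℕ ζ) (≤-reflexive (length-map toℕ ζ)) = refl
  wf : ∀ j → j < length ζ → T (wellFormedˡ k (dropˡ j (encTuple ζ)))
  wf j j<ℓ rewrite dropˡ-encList j (map toℕ ζ) | drop-map {f = toℕ} j ζ with drop j ζ in eq
  ... | []    = ⊥-elim (<-irrefl (sym (cong length eq)) (subst (0 <_) (sym (length-drop j ζ)) (m<n⇒0<n∸m j<ℓ)))
  ... | e ∷ r rewrite tailˡ-encList (toℕ e ∷ map toℕ r) | headˡ-encList (toℕ e) (map toℕ r) =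
    Equivalence.from T-∧ (≡⇒≡ᵇ _ _ (encList-∷ (toℕ e) (map toℕ r)) , <⇒<ᵇ (toℕ<n e))

boundˡ : ℕ → ℕ → ℕ
boundˡ k m = iterate (λ y → 2 ^ k * suc (2 * y)) m 1

encTuple<boundˡ : ∀ {k} (ζ : List (Fin k)) → encTuple ζ < boundˡ k (length ζ)
encTuple<boundˡ     []      = z<s
encTuple<boundˡ {k} (e ∷ ζ) = begin-strict
  encList (toℕ e ∷ map toℕ ζ)         ≡⟨ encList-∷ (toℕ e) (map toℕ ζ) ⟩
  2 ^ toℕ e * suc (2 * encTuple ζ)     ≤⟨ *-monoˡ-≤ _ (^-monoʳ-≤ 2 (<⇒≤ (toℕ<n e))) ⟩
  2 ^ k * suc (2 * encTuple ζ)         <⟨ *-monoʳ-< (2 ^ k) {{m^n≢0 2 k}} (s<s (*-monoʳ-< 2 (encTuple<boundˡ ζ))) ⟩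
  2 ^ k * suc (2 * boundˡ k (length ζ)) ∎
  where open ≤-Reasoning

headˡᶜ : ∀ {n} {X : Vec ℕ n → ℕ} → Computable n X → Computable n (λ xs → headˡ (X xs))
headˡᶜ x = leastᶜ (parityBitᶜ (iterateᶜ ⌊_/2⌋ ⌊ arg (# 0) /2⌋ᶜ (arg (# 0)) (weaken x)) ≡ᵇᶜ constᶜ 1) x

tailˡᶜ : ∀ {n} {X : Vec ℕ n → ℕ} → Computable n X → Computable n (λ xs → tailˡ (X xs))
tailˡᶜ x = ⌊ iterateᶜ ⌊_/2⌋ ⌊ arg (# 0) /2⌋ᶜ (headˡᶜ x) x /2⌋ᶜ

dropˡᶜ : ∀ {n} {J X : Vec ℕ n → ℕ} → Computable n J → Computable n X → Computable n (λ xs → dropˡ (J xs) (X xs))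
dropˡᶜ = iterateᶜ tailˡ (tailˡᶜ (arg (# 0)))

entryˡᶜ : ∀ {n} {J X : Vec ℕ n → ℕ} → Computable n J → Computable n X → Computable n (λ xs → entryˡ (J xs) (X xs))
entryˡᶜ j x = headˡᶜ (dropˡᶜ j x)

wellFormedˡᶜ : ∀ {n} k {Y : Vec ℕ n → ℕ} → Computable n Y → ComputablePred n (λ xs → wellFormedˡ k (Y xs))
wellFormedˡᶜ k y = (y ≡ᵇᶜ 2^ᶜ (headˡᶜ y) *ᶜ sucᶜ (constᶜ 2 *ᶜ tailˡᶜ y)) ∧ᶜ (headˡᶜ y <ᵇᶜ constᶜ k)

isTupleˡᶜ : ∀ {n} k {M X : Vec ℕ n → ℕ} → Computable n M → Computable n X → ComputablePred n (λ xs → isTupleˡ k (M xs) (X xs))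
isTupleˡᶜ k m x = (dropˡᶜ m x ≡ᵇᶜ constᶜ 0) ∧ᶜ notᶜ (anyBelowᶜ (notᶜ (wellFormedˡᶜ k (dropˡᶜ (arg (# 0)) (weaken x)))) m)

boundˡᶜ : ∀ {n} k {M : Vec ℕ n → ℕ} → Computable n M → Computable n (λ xs → boundˡ k (M xs))
boundˡᶜ k m = iterateᶜ _ (2^ᶜ (constᶜ k) *ᶜ sucᶜ (constᶜ 2 *ᶜ arg (# 0))) m (constᶜ 1)

-- Strings and trees

≼-refl : ∀ σ → σ ≼ σ
≼-refl σ = [] , ++-identityʳ σ

≼-trans : ∀ {σ τ υ} → σ ≼ τ → τ ≼ υ → σ ≼ υ
≼-trans {σ} (u , refl) (v , refl) = u ++ v , sym (++-assoc σ u v)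

≼-length : ∀ {σ τ} → σ ≼ τ → length σ ≤ length τ
≼-length {σ} (υ , refl) = subst (length σ ≤_) (sym (length-++ σ)) (m≤m+n _ _)

take-length-++ : ∀ {A : Set} (xs ys : List A) → take (length xs) (xs ++ ys) ≡ xs
take-length-++ []       ys = refl
take-length-++ (x ∷ xs) ys = cong (x ∷_) (take-length-++ xs ys)

≼-take : ∀ {σ τ} → σ ≼ τ → take (length σ) τ ≡ σ
≼-take {σ} (υ , refl) = take-length-++ σ υ

take-≼ : ∀ i τ → take i τ ≼ τ
take-≼ i τ = drop i τ , take++drop≡id i τ

≼-antisym : ∀ {σ τ} → σ ≼ τ → τ ≼ σ → σ ≡ τ
≼-antisym {σ} {τ} σ≼τ τ≼σ = begin
  σ                    ≡⟨ ≼-take σ≼τ ⟨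
  take (length σ) τ    ≡⟨ cong (λ n → take n τ) (≤-antisym (≼-length σ≼τ) (≼-length τ≼σ)) ⟩
  take (length τ) τ    ≡⟨ take-all (length τ) τ ≤-refl ⟩
  τ                    ∎
  where open ≡-Reasoning

≺-length : ∀ {σ τ} → σ ≺ τ → length σ < length τ
≺-length {σ} ((υ , eq) , σ≢τ) with υ
... | []    = ⊥-elim (σ≢τ (trans (sym (++-identityʳ σ)) eq))
... | b ∷ _ = subst (length σ <_) (trans (sym (length-++ σ)) (cong length eq)) (m<m+n (length σ) z<s)

≼∧length<⇒≺ : ∀ {σ τ} → σ ≼ τ → length σ < length τ → σ ≺ τ
≼∧length<⇒≺ σ≼τ lt = σ≼τ , λ { refl → <-irrefl refl lt }

≼-≺-trans : ∀ {σ τ υ} → σ ≼ τ → τ ≺ υ → σ ≺ υ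
≼-≺-trans σ≼τ τ≺υ = ≼∧length<⇒≺ (≼-trans σ≼τ (proj₁ τ≺υ)) (≤-<-trans (≼-length σ≼τ) (≺-length τ≺υ))

≺-snoc : ∀ ρ b → ρ ≺ (ρ ++ b ∷ [])
≺-snoc ρ b = ≼∧length<⇒≺ (b ∷ [] , refl) (subst (length ρ <_) (sym (length-++ ρ)) (m<m+n (length ρ) z<s))

snoc-immediate : ∀ {ρ τ} b → ρ ≺ τ → τ ≺ (ρ ++ b ∷ []) → ⊥
snoc-immediate {ρ} {τ} b ρ≺τ τ≺ρb =
  <-irrefl refl (≤-trans (≺-length τ≺ρb) (subst (_≤ length τ) (sym (trans (length-++ ρ) (+-comm (length ρ) 1))) (≺-length ρ≺τ)))

≼-by-length : ∀ {σ υ τ} → σ ≼ τ → υ ≼ τ → length σ ≤ length υ → σ ≼ υ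
≼-by-length {σ} {υ} {τ} σ≼τ υ≼τ le = subst (_≼ υ) same-prefix (take-≼ (length σ) υ)
  where
  same-prefix : take (length σ) υ ≡ σ
  same-prefix = begin
    take (length σ) υ                        ≡⟨ cong (take (length σ)) (≼-take υ≼τ) ⟨
    take (length σ) (take (length υ) τ)      ≡⟨ take-take (length σ) (length υ) τ ⟩
    take (length σ ⊓ length υ) τ             ≡⟨ cong (λ n → take n τ) (m≤n⇒m⊓n≡m le) ⟩
    take (length σ) τ                        ≡⟨ ≼-take σ≼τ ⟩
    σ                                        ∎
    where open ≡-Reasoning

prefixes-++ : ∀ ρ υ → ∃ λ X → prefixes (ρ ++ υ) ≡ prefixes ρ ++ X
prefixes-++ []      []      = [] , refl
prefixes-++ []      (b ∷ υ) = _ , refl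
prefixes-++ (b ∷ ρ) υ with prefixes-++ ρ υ
... | X , eq = map (b ∷_) X , cong ([] ∷_) (trans (cong (map (b ∷_)) eq) (map-++ (b ∷_) (prefixes ρ) X))

prefixes-last : ∀ ρ → ∃ λ A → prefixes ρ ≡ A ++ ρ ∷ []
prefixes-last []      = [] , refl
prefixes-last (b ∷ ρ) with prefixes-last ρ
... | A , eq = [] ∷ map (b ∷_) A , cong ([] ∷_) (trans (cong (map (b ∷_)) eq) (map-++ (b ∷_) A (ρ ∷ [])))

length-prefixes : ∀ ρ → length (prefixes ρ) ≡ suc (length ρ)
length-prefixes []      = refl
length-prefixes (b ∷ ρ) = cong suc (trans (length-map (b ∷_) (prefixes ρ)) (length-prefixes ρ))

Pre-full : ∀ ρ → Pre full ρ ≡ prefixes ρ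
Pre-full ρ = filter-all (T? ∘ full) (All.universal _ (prefixes ρ))

∣∣-full : ∀ ρ → ∣ ρ ∣[ full ] ≡ suc (length ρ)
∣∣-full ρ = trans (cong length (Pre-full ρ)) (length-prefixes ρ)

Pre-++ : ∀ T ρ υ → ∃ λ Y → Pre T (ρ ++ υ) ≡ Pre T ρ ++ Y
Pre-++ T ρ υ with prefixes-++ ρ υ
... | X , eq = filterᵇ T X , trans (cong (filterᵇ T) eq) (filter-++ (T? ∘ T) (prefixes ρ) X)

Pre-last : ∀ T ρ → ρ ∈T T → ∃ λ A → Pre T ρ ≡ A ++ ρ ∷ []
Pre-last T ρ ρ∈T with prefixes-last ρ
... | A , eq = filterᵇ T A , (begin
  filterᵇ T (prefixes ρ)                ≡⟨ cong (filterᵇ T) eq ⟩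
  filterᵇ T (A ++ ρ ∷ [])               ≡⟨ filter-++ (T? ∘ T) A (ρ ∷ []) ⟩
  filterᵇ T A ++ filterᵇ T (ρ ∷ [])     ≡⟨ cong (filterᵇ T A ++_) (filter-accept (T? ∘ T) (subst Data.Bool.T (sym ρ∈T) _)) ⟩
  filterᵇ T A ++ ρ ∷ []                 ∎)
  where open ≡-Reasoning

nth-Pre : ∀ T {σ ρ} → σ ∈T T → σ ≼ ρ → nth (Pre T ρ) (∣ σ ∣[ T ] ∸ 1) ≡ just σ
nth-Pre T {σ} σ∈T (υ , refl) with Pre-++ T σ υ | Pre-last T σ σ∈T
... | Y , eqY | A , eqA
  rewrite eqY | eqA | ++-assoc A (σ ∷ []) Y | length-++ A {σ ∷ []} | +-∸-assoc (length A) {1} ≤-refl | n∸n≡0 1 | +-identityʳ (length A)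
  = nth-length A
  where
  nth-length : ∀ (A : List Str) {σ Y} → nth (A ++ σ ∷ Y) (length A) ≡ just σ
  nth-length []      = refl
  nth-length (_ ∷ A) = nth-length A

nth-take : ∀ {A : Set} (xs : List A) {i n} → i < n → nth (take n xs) i ≡ nth xs i
nth-take []       {n = suc n} _         = refl
nth-take (x ∷ xs) {zero}  {suc n} _     = refl
nth-take (x ∷ xs) {suc i} {suc n} i<n  = nth-take xs (s≤s⁻¹ i<n)

nth-< : ∀ {A : Set} (xs : List A) {i} → i < length xs → ∃ λ a → nth xs i ≡ just a
nth-< (x ∷ xs) {zero}  _   = x , refl
nth-< (x ∷ xs) {suc i} i<ℓ = nth-< xs (s≤s⁻¹ i<ℓ)

length-take≤ : ∀ {A : Set} {i} (xs : List A) → i ≤ length xs → length (take i xs) ≡ i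
length-take≤ {i = i} xs i≤ℓ = trans (length-take i xs) (m≤n⇒m⊓n≡m i≤ℓ)


module FullTreeSplit {k} {f : TSplit k} (split : IsTreeSplit k full f) where
  open IsTreeSplit split

  length-split : ∀ {ρ ζ} → f ρ ζ ≡ true → length ζ ≡ suc (length ρ)
  length-split {ρ} {ζ} ζ∈f = trans (size ρ refl ζ ζ∈f) (∣∣-full ρ)

  restrict-snoc : ∀ ρ b {ξ} → f (ρ ++ b ∷ []) ξ ≡ true → f ρ (take (suc (length ρ)) ξ) ≡ true
  restrict-snoc ρ b {ξ} ξ∈f = subst (λ n → f ρ (take n ξ) ≡ true) (∣∣-full ρ)
    (proj₂ (union ρ refl not-leaf (take ∣ ρ ∣[ full ] ξ)) (ρ ++ b ∷ [] , immediate , ξ , ξ∈f , refl))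
    where
    not-leaf : ¬ IsLeaf full ρ
    not-leaf leaf = leaf (ρ ++ b ∷ []) refl (≺-snoc ρ b)
    immediate : ImmSucc full ρ (ρ ++ b ∷ [])
    immediate = refl , ≺-snoc ρ b , λ τ _ → snoc-immediate b

  restrict : ∀ {σ τ ξ} → σ ≼ τ → f τ ξ ≡ true → f σ (take (suc (length σ)) ξ) ≡ true
  restrict {σ} {ξ = ξ} (υ , refl) = go σ υ
    where
    go : ∀ σ υ → f (σ ++ υ) ξ ≡ true → f σ (take (suc (length σ)) ξ) ≡ true
    go σ []      ξ∈f = subst (λ ρ → f ρ (take (suc (length ρ)) ξ) ≡ true) (++-identityʳ σ)
                         (subst (λ ζ → f (σ ++ []) ζ ≡ true) (sym (take-all _ ξ (≤-reflexive (length-split ξ∈f)))) ξ∈f)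
    go σ (b ∷ υ) ξ∈f = subst (λ ζ → f σ ζ ≡ true) shorten
                         (restrict-snoc σ b (go (σ ++ b ∷ []) υ (subst (λ ρ → f ρ ξ ≡ true) (sym (++-assoc σ (b ∷ []) υ)) ξ∈f)))
      where
      shorten : take (suc (length σ)) (take (suc (length (σ ++ b ∷ []))) ξ) ≡ take (suc (length σ)) ξ
      shorten = trans (take-take _ _ ξ) (cong (λ n → take n ξ) (m≤n⇒m⊓n≡m (s≤s (≼-length {σ} (b ∷ [] , refl)))))


module PerfectTree {T : Tree} (perfect : IsPerfect T) where
  open IsPerfect perfect

  h-≺ : ∀ {σ τ} → σ ≺ τ → h σ ≺ h τ
  h-≺ {σ} {τ} (σ≼τ , σ≢τ) =
    mono σ τ σ≼τ , λ hσ≡hτ → σ≢τ (≼-antisym σ≼τ (refl' τ σ (subst (h τ ≼_) (sym hσ≡hτ) (≼-refl (h τ)))))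

  h-reflects-≺ : ∀ {σ τ} → h σ ≺ h τ → σ ≺ τ
  h-reflects-≺ {σ} {τ} (hσ≼hτ , hσ≢hτ) = refl' σ τ hσ≼hτ , λ σ≡τ → hσ≢hτ (cong h σ≡τ)

  h-snoc-immediate : ∀ σ b → ImmSucc T (h σ) (h (σ ++ b ∷ []))
  h-snoc-immediate σ b = into _ , h-≺ (≺-snoc σ b) , nothing-between
    where
    nothing-between : ∀ τ → τ ∈T T → h σ ≺ τ → τ ≺ h (σ ++ b ∷ []) → ⊥
    nothing-between τ τ∈T hσ≺τ τ≺hσb with onto τ τ∈T
    ... | υ , refl = snoc-immediate b (h-reflects-≺ hσ≺τ) (h-reflects-≺ τ≺hσb)

  h-stretches : ∀ σ υ → length (h σ) + length υ ≤ length (h (σ ++ υ))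
  h-stretches σ []      = subst (λ ρ → length (h σ) + 0 ≤ length (h ρ)) (sym (++-identityʳ σ)) (≤-reflexive (+-identityʳ _))
  h-stretches σ (b ∷ υ) = begin
    length (h σ) + suc (length υ)        ≡⟨ +-suc (length (h σ)) (length υ) ⟩
    suc (length (h σ)) + length υ        ≤⟨ +-monoˡ-≤ (length υ) (≺-length (h-≺ (≺-snoc σ b))) ⟩
    length (h (σ ++ b ∷ [])) + length υ  ≤⟨ h-stretches (σ ++ b ∷ []) υ ⟩
    length (h ((σ ++ b ∷ []) ++ υ))      ≡⟨ cong (length ∘ h) (++-assoc σ (b ∷ []) υ) ⟩
    length (h (σ ++ b ∷ υ))              ∎
    where open ≤-Reasoning

  long-extension : ∀ {ρ} → ρ ∈T T → ∀ M → ∃ λ τ → τ ∈T T × ρ ≼ τ × M ≤ length τ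
  long-extension ρ∈T M with onto _ ρ∈T
  ... | σ , refl = h (σ ++ replicate M false) , into _ , mono σ _ (replicate M false , refl) ,
                   ≤-trans (≤-trans (≤-reflexive (sym (length-replicate M))) (m≤n+m _ _)) (h-stretches σ (replicate M false))

module SingletonSplit {k} {T : Tree} (perfect : IsPerfect T) (colour : Str → Fin k) where
  open IsPerfect perfect
  open PerfectTree perfect

  word : Str → List (Fin k)
  word ρ = map colour (Pre T ρ)

  split : TSplit k
  split ρ ξ = does (≡-dec _≟ᶠ_ ξ (word ρ))

  split⁻ : ∀ ρ ξ → ξ ∈f split at ρ → ξ ≡ word ρ
  split⁻ ρ ξ ξ∈ with ≡-dec _≟ᶠ_ ξ (word ρ) | ξ∈
  ... | yes ξ≡ | _  = ξ≡
  ... | no _   | ()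

  split⁺ : ∀ ρ → word ρ ∈f split at ρ
  split⁺ ρ with ≡-dec _≟ᶠ_ (word ρ) (word ρ)
  ... | yes _  = refl
  ... | no w≢w = ⊥-elim (w≢w refl)

  word-prefix : ∀ {ρ ρ′} → ρ ≼ ρ′ → take ∣ ρ ∣[ T ] (word ρ′) ≡ word ρ
  word-prefix {ρ} (υ , refl) with Pre-++ T ρ υ
  ... | Y , eq rewrite eq | map-++ colour (Pre T ρ) Y =
    subst (λ n → take n (word ρ ++ map colour Y) ≡ word ρ) (length-map colour (Pre T ρ)) (take-length-++ (word ρ) _)

  isTreeSplit : IsTreeSplit k T split
  isTreeSplit = record
    { size     = λ ρ _ ξ ξ∈ → trans (cong length (split⁻ ρ ξ ξ∈)) (length-map colour (Pre T ρ))
    ; nonempty = λ ρ _ → word ρ , split⁺ ρ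
    ; union    = λ ρ ρ∈T _ ζ → extend ρ ρ∈T ζ , restrict-word ρ ζ
    }
    where
    extend : ∀ ρ → ρ ∈T T → ∀ ζ → ζ ∈f split at ρ →
             ∃ λ ρ⁺ → ImmSucc T ρ ρ⁺ × ∃ λ ζ⁺ → ζ⁺ ∈f split at ρ⁺ × take ∣ ρ ∣[ T ] ζ⁺ ≡ ζ
    extend ρ ρ∈T ζ ζ∈ with onto ρ ρ∈T
    ... | σ , refl = h (σ ++ false ∷ []) , h-snoc-immediate σ false , word (h (σ ++ false ∷ [])) , split⁺ (h (σ ++ false ∷ [])) ,
                     trans (word-prefix (proj₁ (h-≺ (≺-snoc σ false)))) (sym (split⁻ (h σ) ζ ζ∈))
    restrict-word : ∀ ρ ζ → (∃ λ ρ⁺ → ImmSucc T ρ ρ⁺ × ∃ λ ζ⁺ → ζ⁺ ∈f split at ρ⁺ × take ∣ ρ ∣[ T ] ζ⁺ ≡ ζ) →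
                    ζ ∈f split at ρ
    restrict-word ρ ζ (ρ⁺ , (_ , ρ≺ρ⁺ , _) , ζ⁺ , ζ⁺∈ , restricts) =
      subst (λ z → z ∈f split at ρ)
            (trans (sym (word-prefix (proj₁ ρ≺ρ⁺))) (trans (cong (take ∣ ρ ∣[ T ]) (sym (split⁻ ρ⁺ ζ⁺ ζ⁺∈))) restricts))
            (split⁺ ρ)

  homogeneous : ∀ {f : TSplit k} →
                (∀ ρ → ρ ∈T T → ∃ λ ξ → f ρ ξ ≡ true × ∀ σ → σ ∈T T → σ ≼ ρ → nth ξ (length σ) ≡ just (colour σ)) →
                Homogeneous k T full f
  homogeneous {f} realised = split , isTreeSplit , induced , λ ρ _ → word ρ , λ ξ → split⁻ ρ ξ , λ { refl → split⁺ ρ }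
    where
    induced : Induced T split full f
    induced ρ ρ∈T ξh ξh∈ with realised ρ ρ∈T
    ... | ξ , ξ∈f , entries = ξ , ξ∈f , λ σ σ∈T σ≼ρ → begin
      entry T ξh σ                                            ≡⟨ cong (λ w → entry T w σ) (split⁻ ρ ξh ξh∈) ⟩
      nth (word ρ) (∣ σ ∣[ T ] ∸ 1)                           ≡⟨ nth-map colour (Pre T ρ) _ ⟩
      Data.Maybe.map colour (nth (Pre T ρ) (∣ σ ∣[ T ] ∸ 1))  ≡⟨ cong (Data.Maybe.map colour) (nth-Pre T σ∈T σ≼ρ) ⟩
      just (colour σ)                                         ≡⟨ entries σ σ∈T σ≼ρ ⟨
      nth ξ (length σ)                                        ≡⟨ cong (λ n → nth ξ (n ∸ 1)) (∣∣-full σ) ⟨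
      entry full ξ σ                                          ∎
      where open ≡-Reasoning

-- The colouring

module Colouring (k₀ : ℕ) (c : JCode 2) where

  k : ℕ
  k = suc k₀

  -- approx returns suc 1: by stage s, c has answered 1 on the codes p and x
  believed : ℕ → ℕ → ℕ → Bool
  believed s p x = Jump.approx c s (p ∷ x ∷ []) ≡ᵇ 2

  candidate : ℕ → ℕ → ℕ → ℕ → Bool
  candidate s p m x = isTupleˡ k m x ∧ believed s p x

  decides : ℕ → ℕ → ℕ → ℕ → ℕ → Bool
  decides s p m j e = anyBelow (candidate s p m) (boundˡ k m)
                    ∧ not (anyBelow (λ x → candidate s p m x ∧ not (entryˡ j x ≡ᵇ e)) (boundˡ k m))

  -- a and b code strings σ and τ; b also serves as the stage of approximation
  settles : ℕ → ℕ → ℕ → Bool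
  settles a b i = (lengthˢ a <ᵇ suc i) ∧ anyBelow (decides b (takeˢ i b) (suc i) (lengthˢ a)) k

  level : ℕ → ℕ → ℕ
  level a b = least (settles a b) b

  -- searching below k₀ keeps the value below k; it is junk if no entry is decided
  colour : ℕ → ℕ → ℕ
  colour a b = least (decides b (takeˢ (level a b) b) (suc (level a b)) (lengthˢ a)) k₀

  Col : Coloring k
  Col σ τ = fromℕ< {colour (encStr σ) (encStr τ)} (s≤s (least-≤ _ k₀))

  toℕ-Col : ∀ σ τ → toℕ (Col σ τ) ≡ colour (encStr σ) (encStr τ)
  toℕ-Col σ τ = toℕ-fromℕ< (s≤s (least-≤ _ k₀))

  believedᶜ : ∀ {n} {S P X : Vec ℕ n → ℕ} → Computable n S → Computable n P → Computable n X →
              ComputablePred n (λ xs → believed (S xs) (P xs) (X xs))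
  believedᶜ s p x = compose (Jump.approxᶜ c) (s ∷ p ∷ x ∷ []) ≡ᵇᶜ constᶜ 2

  candidateᶜ : ∀ {n} {S P M X : Vec ℕ n → ℕ} → Computable n S → Computable n P → Computable n M → Computable n X →
               ComputablePred n (λ xs → candidate (S xs) (P xs) (M xs) (X xs))
  candidateᶜ s p m x = isTupleˡᶜ k m x ∧ᶜ believedᶜ s p x

  decidesᶜ : ∀ {n} {S P M J E : Vec ℕ n → ℕ} → Computable n S → Computable n P → Computable n M → Computable n J → Computable n E →
             ComputablePred n (λ xs → decides (S xs) (P xs) (M xs) (J xs) (E xs))
  decidesᶜ s p m j e =
    anyBelowᶜ (candidateᶜ (weaken s) (weaken p) (weaken m) (arg (# 0))) (boundˡᶜ k m)
    ∧ᶜ notᶜ (anyBelowᶜ (candidateᶜ (weaken s) (weaken p) (weaken m) (arg (# 0))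
                        ∧ᶜ notᶜ (entryˡᶜ (weaken j) (arg (# 0)) ≡ᵇᶜ weaken e))
                       (boundˡᶜ k m))

  settlesᶜ : ∀ {n} {A B I : Vec ℕ n → ℕ} → Computable n A → Computable n B → Computable n I →
             ComputablePred n (λ xs → settles (A xs) (B xs) (I xs))
  settlesᶜ a b i = (lengthˢᶜ a <ᵇᶜ sucᶜ i)
                 ∧ᶜ anyBelowᶜ (decidesᶜ (weaken b) (takeˢᶜ (weaken i) (weaken b)) (sucᶜ (weaken i)) (lengthˢᶜ (weaken a)) (arg (# 0)))
                              (constᶜ k)

  levelᶜ : ∀ {n} {A B : Vec ℕ n → ℕ} → Computable n A → Computable n B → Computable n (λ xs → level (A xs) (B xs))
  levelᶜ a b = leastᶜ (settlesᶜ (weaken a) (weaken b) (arg (# 0))) b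

  colourᶜ : ∀ {n} {A B : Vec ℕ n → ℕ} → Computable n A → Computable n B → Computable n (λ xs → colour (A xs) (B xs))
  colourᶜ a b =
    leastᶜ (decidesᶜ (weaken b) (takeˢᶜ (weaken (levelᶜ a b)) (weaken b)) (sucᶜ (weaken (levelᶜ a b))) (lengthˢᶜ (weaken a)) (arg (# 0)))
           (constᶜ k₀)

  Col-computable : ComputableColoring Col
  Col-computable = code colour₂ᶜ , λ σ τ _ →
    subst (PEval (code colour₂ᶜ) _) (sym (toℕ-Col σ τ)) (computes colour₂ᶜ (encStr σ ∷ encStr τ ∷ []))
    where
    colour₂ᶜ : Computable 2 (λ xs → colour (Vec.lookup xs zero) (Vec.lookup xs (suc zero)))
    colour₂ᶜ = colourᶜ (arg (# 0)) (arg (# 1))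

module Analysis (k₀ : ℕ) (f : TSplit (suc k₀)) (split : IsTreeSplit (suc k₀) full f) (stable : WeaklyStableSplit full f)
                (c : JCode 2) (c-computes : ∀ ρ ζ → JEval c (encStr ρ ∷ encTuple ζ ∷ []) (χ (f ρ ζ))) where
  open Colouring k₀ c public
  open FullTreeSplit split
  open IsTreeSplit split using (nonempty)

  Correct : ℕ → Str → Set
  Correct s ρ = ∀ ζ → length ζ ≡ suc (length ρ) → believed s (encStr ρ) (encTuple ζ) ≡ f ρ ζ

  CorrectUpTo : ℕ → ℕ → Set
  CorrectUpTo L s = ∀ ρ → length ρ ≤ L → Correct s ρ

  correct-eventually : ∀ L → Eventually (CorrectUpTo L)
  correct-eventually L =
    eventually-map (λ correct ρ ρ≤L → correct (length ρ) (s≤s ρ≤L) ρ refl)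
      (eventually-∀< (suc L) λ ℓ _ → words-eventually-∀ Bool-eventually-∀ ℓ λ ρ _ →
         words-eventually-∀ (Fin-eventually-∀ k) (suc (length ρ)) λ ζ _ → believed-converges ρ ζ)
    where
    reads : ∀ b → (suc (χ b) ≡ᵇ 2) ≡ b
    reads false = refl
    reads true  = refl
    believed-converges : ∀ ρ ζ → Eventually (λ s → believed s (encStr ρ) (encTuple ζ) ≡ f ρ ζ)
    believed-converges ρ ζ = eventually-map (λ e → trans (cong (_≡ᵇ 2) e) (reads (f ρ ζ))) (Δ⁰₂-approximation (c-computes ρ ζ))

  Decided : Str → ℕ → Fin k → Set
  Decided ρ j e = (∃ λ ζ → f ρ ζ ≡ true) × (∀ ζ → f ρ ζ ≡ true → nth ζ j ≡ just e)

  Decided-unique : ∀ {ρ j e e′} → Decided ρ j e → Decided ρ j e′ → e ≡ e′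
  Decided-unique ((ζ , ζ∈f) , agree) (_ , agree′) = just-injective (trans (sym (agree ζ ζ∈f)) (agree′ ζ ζ∈f))

  module AtCorrectStage {s ρ} (correct : Correct s ρ) where

    candidates : ℕ → Bool
    candidates = candidate s (encStr ρ) (suc (length ρ))

    bound : ℕ
    bound = boundˡ k (suc (length ρ))

    candidate-sound : ∀ x → T (candidates x) → ∃ λ ζ → f ρ ζ ≡ true × encTuple ζ ≡ x
    candidate-sound x cand with Equivalence.to T-∧ cand
    ... | tuple , belief with isTupleˡ-decode k _ x tuple
    ...   | ζ , len , refl = ζ , trans (sym (correct ζ len)) (Equivalence.to T-≡ belief) , refl

    candidate-complete : ∀ ζ → f ρ ζ ≡ true → T (candidates (encTuple ζ))
    candidate-complete ζ ζ∈f = Equivalence.from T-∧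
      ( subst (λ m → T (isTupleˡ k m (encTuple ζ))) (length-split ζ∈f) (isTupleˡ-encTuple ζ)
      , Equivalence.from T-≡ (trans (correct ζ (length-split ζ∈f)) ζ∈f))

    below-bound : ∀ ζ → f ρ ζ ≡ true → encTuple ζ < bound
    below-bound ζ ζ∈f = subst (λ m → encTuple ζ < boundˡ k m) (length-split ζ∈f) (encTuple<boundˡ ζ)

    agreement : ∀ {j v} → T (not (anyBelow (λ x → candidates x ∧ not (entryˡ j x ≡ᵇ v)) bound)) →
                ∀ ζ → f ρ ζ ≡ true → entryˡ j (encTuple ζ) ≡ v
    agreement none ζ ζ∈f = ≡ᵇ⇒≡ _ _ (decidable-stable (T? _) λ differs →
      T-not⁻ none (anyBelow⁺ _ _ (below-bound ζ ζ∈f) (Equivalence.from T-∧ (candidate-complete ζ ζ∈f , T-not⁺ differs))))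

    entry-nth : ∀ {j ζ e} → j ≤ length ρ → f ρ ζ ≡ true → entryˡ j (encTuple ζ) ≡ toℕ e → nth ζ j ≡ just e
    entry-nth {j} {ζ} j≤ℓ ζ∈f entry≡ with nth-< ζ (subst (j <_) (sym (length-split ζ∈f)) (s≤s j≤ℓ))
    ... | e′ , nth≡ = trans nth≡ (cong just (toℕ-injective (trans (sym (entryˡ-encTuple ζ j nth≡)) entry≡)))

    decides-sound : ∀ {j v} → j ≤ length ρ → T (decides s (encStr ρ) (suc (length ρ)) j v) →
                    ∃ λ e → toℕ e ≡ v × Decided ρ j e
    decides-sound {j} {v} j≤ℓ dec with Equivalence.to T-∧ dec
    ... | some , none with anyBelow⁻ candidates bound some
    ...   | x , _ , cand with candidate-sound x cand
    ...     | ζ , ζ∈f , refl with nth-< ζ (subst (j <_) (sym (length-split ζ∈f)) (s≤s j≤ℓ))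
    ...       | e , nth≡ =
      e , e≡v , (ζ , ζ∈f) , λ ζ′ ζ′∈f → entry-nth j≤ℓ ζ′∈f (trans (agreement {j} {v} none ζ′ ζ′∈f) (sym e≡v))
      where
      e≡v : toℕ e ≡ v
      e≡v = trans (sym (entryˡ-encTuple ζ j nth≡)) (agreement {j} {v} none ζ ζ∈f)

    decides-complete : ∀ {j e} → Decided ρ j e → T (decides s (encStr ρ) (suc (length ρ)) j (toℕ e))
    decides-complete {j} {e} ((ζ , ζ∈f) , agree) =
      Equivalence.from T-∧ (anyBelow⁺ _ _ (below-bound ζ ζ∈f) (candidate-complete ζ ζ∈f) , T-not⁺ none)
      where
      none : ¬ T (anyBelow (λ x → candidates x ∧ not (entryˡ j x ≡ᵇ toℕ e)) bound)
      none some with anyBelow⁻ (λ x → candidates x ∧ not (entryˡ j x ≡ᵇ toℕ e)) bound some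
      ... | x , _ , cand∧differs = refute x (Equivalence.to (T-∧ {candidates x}) cand∧differs)
        where
        refute : ∀ x → T (candidates x) × T (not (entryˡ j x ≡ᵇ toℕ e)) → ⊥
        refute x (cand , differs) with candidate-sound x cand
        ... | ζ′ , ζ′∈f , refl = T-not⁻ differs (≡⇒≡ᵇ _ _ (entryˡ-encTuple ζ′ j (agree ζ′ ζ′∈f)))

    decided-value : ∀ {j e} → j ≤ length ρ → Decided ρ j e → least (decides s (encStr ρ) (suc (length ρ)) j) k₀ ≡ toℕ e
    decided-value j≤ℓ dec = least-≡ _ k₀ (decides-complete dec) (s≤s⁻¹ (toℕ<n _)) λ u u<e dec-u →
      let (e′ , e′≡u , dec′) = decides-sound j≤ℓ dec-u in
      <-irrefl (trans (sym e′≡u) (cong toℕ (Decided-unique dec′ dec))) u<e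

  settles-encStr : ∀ σ τ {i} → i ≤ length τ → settles (encStr σ) (encStr τ) i ≡
                   (length σ <ᵇ suc i) ∧ anyBelow (decides (encStr τ) (encStr (take i τ)) (suc (length (take i τ))) (length σ)) k
  settles-encStr σ τ {i} i≤ℓ rewrite lengthˢ-encStr σ | takeˢ-encStr i τ | length-take≤ τ i≤ℓ = refl

  settles-sound : ∀ σ τ {i} → Correct (encStr τ) (take i τ) → i ≤ length τ → T (settles (encStr σ) (encStr τ) i) →
                  length σ ≤ i × ∃ λ e → Decided (take i τ) (length σ) e
  settles-sound σ τ {i} correct i≤ℓ settled = σ≤i , proj₁ sound , proj₂ (proj₂ sound)
    where
    decides-at-i : ℕ → Bool
    decides-at-i = decides (encStr τ) (encStr (take i τ)) (suc (length (take i τ))) (length σ)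
    parts : T (length σ <ᵇ suc i) × T (anyBelow decides-at-i k)
    parts = Equivalence.to (T-∧ {length σ <ᵇ suc i} {anyBelow decides-at-i k}) (subst T (settles-encStr σ τ i≤ℓ) settled)
    σ≤i : length σ ≤ i
    σ≤i = s≤s⁻¹ (<ᵇ⇒< (length σ) (suc i) (proj₁ parts))
    witness : ∃ λ v → v < k × T (decides-at-i v)
    witness = anyBelow⁻ decides-at-i k (proj₂ parts)
    sound : ∃ λ e → toℕ e ≡ proj₁ witness × Decided (take i τ) (length σ) e
    sound = AtCorrectStage.decides-sound correct (≤-trans σ≤i (≤-reflexive (sym (length-take≤ τ i≤ℓ)))) (proj₂ (proj₂ witness))

  settles-complete : ∀ σ τ {i e} → Correct (encStr τ) (take i τ) → i ≤ length τ → length σ ≤ i →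
                     Decided (take i τ) (length σ) e → T (settles (encStr σ) (encStr τ) i)
  settles-complete σ τ {i} {e} correct i≤ℓ σ≤i decided = subst T (sym (settles-encStr σ τ i≤ℓ))
    (Equivalence.from T-∧ (<⇒<ᵇ (s≤s σ≤i) ,
      anyBelow⁺ (decides (encStr τ) (encStr (take i τ)) (suc (length (take i τ))) (length σ)) k (toℕ<n e)
                (AtCorrectStage.decides-complete correct decided)))

  colour-encStr : ∀ σ τ → level (encStr σ) (encStr τ) ≤ length τ → colour (encStr σ) (encStr τ) ≡
                  least (decides (encStr τ) (encStr (take (level (encStr σ) (encStr τ)) τ))
                                 (suc (length (take (level (encStr σ) (encStr τ)) τ))) (length σ)) k₀
  colour-encStr σ τ = at-level (level (encStr σ) (encStr τ))
    where
    at-level : ∀ ℓ → ℓ ≤ length τ → least (decides (encStr τ) (takeˢ ℓ (encStr τ)) (suc ℓ) (lengthˢ (encStr σ))) k₀ ≡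
                                    least (decides (encStr τ) (encStr (take ℓ τ)) (suc (length (take ℓ τ))) (length σ)) k₀
    at-level ℓ ℓ≤τ rewrite lengthˢ-encStr σ | takeˢ-encStr ℓ τ | length-take≤ τ ℓ≤τ = refl

  level-decided : ∀ σ τ {L e} → CorrectUpTo L (encStr τ) → length σ ≤ L → L ≤ length τ → Decided (take L τ) (length σ) e →
                  ∃ λ ℓ → length σ ≤ ℓ × ℓ ≤ length τ × Decided (take ℓ τ) (length σ) (Col σ τ)
  level-decided σ τ {L} correct σ≤L L≤τ decided-at-L =
    ℓ , proj₁ sound , ℓ≤τ , subst (Decided (take ℓ τ) (length σ)) (sym Col≡e) decided
    where
    ℓ : ℕ
    ℓ = level (encStr σ) (encStr τ)
    correct-at : ∀ {i} → i ≤ L → Correct (encStr τ) (take i τ)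
    correct-at {i} i≤L = correct (take i τ) (≤-trans (≤-reflexive (length-take i τ)) (≤-trans (m⊓n≤m i _) i≤L))
    settled-at-L : T (settles (encStr σ) (encStr τ) L)
    settled-at-L = settles-complete σ τ (correct-at ≤-refl) L≤τ σ≤L decided-at-L
    ℓ≤L : ℓ ≤ L
    ℓ≤L = least-≤-witness (settles (encStr σ) (encStr τ)) (encStr τ) settled-at-L
    ℓ≤τ : ℓ ≤ length τ
    ℓ≤τ = ≤-trans ℓ≤L L≤τ
    settled-at-ℓ : T (settles (encStr σ) (encStr τ) ℓ)
    settled-at-ℓ = least-satisfies (settles (encStr σ) (encStr τ)) (encStr τ) settled-at-L (≤-trans L≤τ (length≤encStr τ))
    sound : length σ ≤ ℓ × ∃ λ e → Decided (take ℓ τ) (length σ) e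
    sound = settles-sound σ τ (correct-at ℓ≤L) ℓ≤τ settled-at-ℓ
    e : Fin k
    e = proj₁ (proj₂ sound)
    decided : Decided (take ℓ τ) (length σ) e
    decided = proj₂ (proj₂ sound)
    Col≡e : Col σ τ ≡ e
    Col≡e = toℕ-injective (trans (toℕ-Col σ τ) (trans (colour-encStr σ τ ℓ≤τ)
              (AtCorrectStage.decided-value (correct-at ℓ≤L) (≤-trans (proj₁ sound) (≤-reflexive (sym (length-take≤ τ ℓ≤τ)))) decided)))

  stable-decided : ∀ σ → ∃ λ d → ∀ ρ → σ ≼ ρ → d ≤ length ρ → ∃ λ e → Decided ρ (length σ) e
  stable-decided σ with stable σ refl
  ... | d , restrictions = d , decided
    where
    j : ℕ
    j = length σ
    decided : ∀ ρ → σ ≼ ρ → d ≤ length ρ → ∃ λ e → Decided ρ j e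
    decided ρ σ≼ρ d≤ρ with restrictions ρ refl σ≼ρ (≤-trans d≤ρ (≤-trans (n≤1+n _) (≤-reflexive (sym (∣∣-full ρ)))))
                         | nonempty ρ refl
    ... | ζ₀ , _ , only-ζ₀ | ζ , ζ∈f with nth-< ζ (subst (j <_) (sym (length-split ζ∈f)) (s≤s (≼-length σ≼ρ)))
    ...   | e , nth≡ = e , (ζ , ζ∈f) , λ ζ′ ζ′∈f → begin
      nth ζ′ j                ≡⟨ nth-take ζ′ (n<1+n j) ⟨
      nth (take (suc j) ζ′) j ≡⟨ cong (λ η → nth η j) (trans (cut ζ′ ζ′∈f) (sym (cut ζ ζ∈f))) ⟩
      nth (take (suc j) ζ) j  ≡⟨ nth-take ζ (n<1+n j) ⟩
      nth ζ j                 ≡⟨ nth≡ ⟩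
      just e                  ∎
      where
      open ≡-Reasoning
      cut : ∀ ζ → f ρ ζ ≡ true → take (suc j) ζ ≡ ζ₀
      cut ζ ζ∈f = subst (λ n → take n ζ ≡ ζ₀) (∣∣-full σ) (proj₁ (only-ζ₀ (take ∣ σ ∣[ full ] ζ)) (ζ , ζ∈f , refl))

  colour-from-level : ∀ σ τ {L e} → CorrectUpTo L (encStr τ) → length σ ≤ L → L ≤ length τ → Decided (take L τ) (length σ) e →
                      ∀ ξ → f τ ξ ≡ true → nth ξ (length σ) ≡ just (Col σ τ)
  colour-from-level σ τ correct σ≤L L≤τ decided ξ ξ∈f = proof
    where
    result : ∃ λ ℓ → length σ ≤ ℓ × ℓ ≤ length τ × Decided (take ℓ τ) (length σ) (Col σ τ)
    result = level-decided σ τ correct σ≤L L≤τ decided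
    ℓ : ℕ
    ℓ = proj₁ result
    σ<1+ℓ : length σ < suc (length (take ℓ τ))
    σ<1+ℓ = s≤s (subst (length σ ≤_) (sym (length-take≤ τ (proj₁ (proj₂ (proj₂ result))))) (proj₁ (proj₂ result)))
    restricted : f (take ℓ τ) (take (suc (length (take ℓ τ))) ξ) ≡ true
    restricted = restrict (take-≼ ℓ τ) ξ∈f
    proof : nth ξ (length σ) ≡ just (Col σ τ)
    proof = trans (sym (nth-take ξ σ<1+ℓ)) (proj₂ (proj₂ (proj₂ (proj₂ result))) (take (suc (length (take ℓ τ))) ξ) restricted)

  colour-entry : ∀ σ → ∃ λ N → ∀ τ → σ ≺ τ → N ≤ length τ →
                 ∀ ξ → f τ ξ ≡ true → nth ξ (length σ) ≡ just (Col σ τ)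
  colour-entry σ = L ⊔ S , λ τ σ≺τ N≤τ →
    colour-from-level σ τ (correct τ N≤τ) (m≤m⊔n (length σ) d) (L≤τ τ N≤τ) (proj₂ (decided-at-L τ σ≺τ N≤τ))
    where
    d : ℕ
    d = proj₁ (stable-decided σ)
    L : ℕ
    L = length σ ⊔ d
    S : ℕ
    S = proj₁ (correct-eventually L)
    correct : ∀ τ → L ⊔ S ≤ length τ → CorrectUpTo L (encStr τ)
    correct τ N≤τ = proj₂ (correct-eventually L) (encStr τ) (≤-trans (m≤n⊔m L S) (≤-trans N≤τ (length≤encStr τ)))
    L≤τ : ∀ τ → L ⊔ S ≤ length τ → L ≤ length τ
    L≤τ τ N≤τ = ≤-trans (m≤m⊔n L S) N≤τ
    decided-at-L : ∀ τ → σ ≺ τ → L ⊔ S ≤ length τ → ∃ λ e → Decided (take L τ) (length σ) e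
    decided-at-L τ σ≺τ N≤τ = proj₂ (stable-decided σ) (take L τ)
      (≼-by-length (proj₁ σ≺τ) (take-≼ L τ) (≤-trans (m≤m⊔n (length σ) d) (≤-reflexive (sym length-τ↾L))))
      (≤-trans (m≤n⊔m (length σ) d) (≤-reflexive (sym length-τ↾L)))
      where
      length-τ↾L : length (take L τ) ≡ L
      length-τ↾L = length-take≤ τ (L≤τ τ N≤τ)

  Col-weaklyStable : WeaklyStableColoring full Col
  Col-weaklyStable σ _ = suc (N ⊔ d) , constant
    where
    N : ℕ
    N = proj₁ (colour-entry σ)
    d : ℕ
    d = proj₁ (stable-decided σ)
    constant : ∀ ρ → ρ ∈T full → σ ≼ ρ → ∣ ρ ∣[ full ] ≡ suc (N ⊔ d) →
               ∃ λ k′ → ∀ τ → τ ∈T full → ρ ≺ τ → Col σ τ ≡ k′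
    constant ρ _ σ≼ρ ρ-level = e , λ τ _ ρ≺τ → colour-is-e τ ρ≺τ (nonempty τ refl)
      where
      length-ρ : length ρ ≡ N ⊔ d
      length-ρ = suc-injective (trans (sym (∣∣-full ρ)) ρ-level)
      decided : ∃ λ e → Decided ρ (length σ) e
      decided = proj₂ (stable-decided σ) ρ σ≼ρ (subst (d ≤_) (sym length-ρ) (m≤n⊔m N d))
      e : Fin k
      e = proj₁ decided
      colour-is-e : ∀ τ → ρ ≺ τ → (∃ λ ξ → f τ ξ ≡ true) → Col σ τ ≡ e
      colour-is-e τ ρ≺τ (ξ , ξ∈f) = just-injective (begin
        just (Col σ τ)                           ≡⟨ proj₂ (colour-entry σ) τ (≼-≺-trans σ≼ρ ρ≺τ) N≤τ ξ ξ∈f ⟨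
        nth ξ (length σ)                         ≡⟨ nth-take ξ (s≤s (≼-length σ≼ρ)) ⟨
        nth (take (suc (length ρ)) ξ) (length σ) ≡⟨ proj₂ (proj₂ decided) _ (restrict (proj₁ ρ≺τ) ξ∈f) ⟩
        just e                                   ∎)
        where
        open ≡-Reasoning
        N≤τ : N ≤ length τ
        N≤τ = ≤-trans (m≤m⊔n N d) (≤-trans (≤-reflexive (sym length-ρ)) (<⇒≤ (≺-length ρ≺τ)))

  module OnStableTree {T : Tree} (perfect : IsPerfect T) (stable-on-T : StableColoring T Col) where
    open PerfectTree perfect using (long-extension)

    eventually-constant : ∀ σ → ∃ λ (col : Fin k) → ∃ λ (L : List Str) →
                          σ ∈T T → ∀ ρ → ρ ∈T T → σ ≺ ρ → ρ ∉ L → Col σ ρ ≡ col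
    eventually-constant σ = by-membership (T σ) refl
      where
      by-membership : ∀ b → T σ ≡ b → ∃ λ (col : Fin k) → ∃ λ (L : List Str) →
                      σ ∈T T → ∀ ρ → ρ ∈T T → σ ≺ ρ → ρ ∉ L → Col σ ρ ≡ col
      by-membership true  σ∈T = let (col , L , constant) = stable-on-T σ σ∈T in col , L , λ _ → constant
      by-membership false σ∉T = zero , [] , λ σ∈T → ⊥-elim (case trans (sym σ∈T) σ∉T of λ ())

    limit : Str → Fin k
    limit σ = proj₁ (eventually-constant σ)

    settling-length : Str → ℕ
    settling-length σ = proj₁ (colour-entry σ) ⊔ max 0 (map length (proj₁ (proj₂ (eventually-constant σ))))

    horizon : Str → ℕ
    horizon ρ = max 0 (applyUpTo (λ i → settling-length (take i ρ)) (suc (length ρ)))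

    settling≤horizon : ∀ {σ ρ} → σ ≼ ρ → settling-length σ ≤ horizon ρ
    settling≤horizon {σ} {ρ} σ≼ρ = subst (λ υ → settling-length υ ≤ horizon ρ) (≼-take σ≼ρ)
      (All.lookup (xs≤max 0 _) (∈-applyUpTo⁺ (λ i → settling-length (take i ρ)) (s≤s (≼-length σ≼ρ))))

    realised : ∀ ρ → ρ ∈T T → ∃ λ ξ → f ρ ξ ≡ true × ∀ σ → σ ∈T T → σ ≼ ρ → nth ξ (length σ) ≡ just (limit σ)
    realised ρ ρ∈T = take (suc (length ρ)) ξ , restrict ρ≼τ ξ∈f , entries
      where
      extension : ∃ λ τ → τ ∈T T × ρ ≼ τ × suc (length ρ ⊔ horizon ρ) ≤ length τ
      extension = long-extension ρ∈T (suc (length ρ ⊔ horizon ρ))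
      τ : Str
      τ = proj₁ extension
      τ∈T : τ ∈T T
      τ∈T = proj₁ (proj₂ extension)
      ρ≼τ : ρ ≼ τ
      ρ≼τ = proj₁ (proj₂ (proj₂ extension))
      long : suc (length ρ ⊔ horizon ρ) ≤ length τ
      long = proj₂ (proj₂ (proj₂ extension))
      ξ : List (Fin k)
      ξ = proj₁ (nonempty τ refl)
      ξ∈f : f τ ξ ≡ true
      ξ∈f = proj₂ (nonempty τ refl)
      entries : ∀ σ → σ ∈T T → σ ≼ ρ → nth (take (suc (length ρ)) ξ) (length σ) ≡ just (limit σ)
      entries σ σ∈T σ≼ρ = begin
        nth (take (suc (length ρ)) ξ) (length σ)  ≡⟨ nth-take ξ (s≤s (≼-length σ≼ρ)) ⟩
        nth ξ (length σ)                          ≡⟨ proj₂ (colour-entry σ) τ σ≺τ (≤-trans (m≤m⊔n _ _) (<⇒≤ settled)) ξ ξ∈f ⟩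
        just (Col σ τ)                            ≡⟨ cong just (proj₂ (proj₂ (eventually-constant σ)) σ∈T τ τ∈T σ≺τ τ∉L) ⟩
        just (limit σ)                            ∎
        where
        open ≡-Reasoning
        settled : settling-length σ < length τ
        settled = <-≤-trans (s≤s (≤-trans (settling≤horizon σ≼ρ) (m≤n⊔m (length ρ) _))) long
        σ≺τ : σ ≺ τ
        σ≺τ = ≼∧length<⇒≺ (≼-trans σ≼ρ ρ≼τ) (<-≤-trans (s≤s (≼-length σ≼ρ)) (≤-trans (s≤s (m≤m⊔n _ _)) long))
        τ∉L : τ ∉ proj₁ (proj₂ (eventually-constant σ))
        τ∉L τ∈ = <-irrefl refl (≤-<-trans (≤-trans (All.lookup (xs≤max 0 _) (∈-map⁺ length τ∈)) (m≤n⊔m _ _)) settled)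

proposition3p11 : (k : ℕ) → 1 ≤ k → (f : TSplit k) → IsTreeSplit k full f → WeaklyStableSplit full f → Delta02Split f →
    Σ (Coloring k) (λ C → ComputableColoring C × WeaklyStableColoring full C ×
      ((T : Tree) → IsPerfect T → StableColoring T C → Homogeneous k T full f))
proposition3p11 zero     () _ _ _ _
proposition3p11 (suc k₀) _  f split stable (c , c-computes) =
  Col , Col-computable , Col-weaklyStable ,
  λ T perfect stable-on-T → SingletonSplit.homogeneous perfect (OnStableTree.limit perfect stable-on-T)
                                                      (OnStableTree.realised perfect stable-on-T)
  where open Analysis k₀ f split stable c c-computes
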